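{- Let $u\ge1$, $n=4u-1$, $r_1=2u-1$, $r_2=2u$, and let $(Y,w)$ be a weighted subset of the union of the two shells $X_{r_1}\cup X_{r_2}$ in $H(n,2)$ with $w\equiv1$. Let $\mathcal B_{r_\nu}=\{B_y: y\in Y\cap X_{r_\nu}\}$ for $\nu=1,2$. Then $(Y,w)$ is a tight relative $3$-design if and only if $(V,\mathcal B_{r_1})$ is a symmetric $2$-$(4u-1,2u-1,u-1)$ design and $(V,\mathcal B_{r_2})$ is the complementary design of $(V,\mathcal B_{r_1})$, i.e. $\mathcal B_{r_2}=\{V\setminus B: B\in\mathcal B_{r_1}\}$.
   Context: Let $V=\{1,\dots,n\}$, let $X=\{0,1\}^n$ be the point set of the binary Hamming scheme $H(n,2)$, $u_0=(0,\dots,0)$, and let the shell $X_r$ be the set of vectors in $X$ with exactly $r$ ones. For $x\in X$ put $B_x=\{i\in V: x_i=1\}$. If $Y\subset X_{r_1}\cup X_{r_2}$ with $r_1\neq r_2$ and $w:Y\to\mathbb R_{>0}$, put $Y_{r_\nu}=Y\cap X_{r_\nu}$ and $w(Y_{r_\nu})=\sum_{y\in Y_{r_\nu}}w(y)$; then $(Y,w)$ is a relative $t$-design with respect to $u_0$ if for every $1\le j\le t$ and every $z\in X_j$ $$\sum_{\nu=1}^2\frac{w(Y_{r_\nu})}{|X_{r_\nu}|}\sum_{x\in X_{r_\nu}}f_z(x)=\sum_{y\in Y}w(y)f_z(y),$$ where $f_z(x)=1$ if $B_z\subset B_x$ and $f_z(x)=0$ otherwise. (For $H(n,2)$ this P-structure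 definition coincides with the Q-structure one.) A relative $(2e+1)$-design $(Y,w)$ on two shells $X_{r_1}\cup X_{r_2}$ (both $Y_{r_1},Y_{r_2}$ nonempty) with $w$ constant on each $Y_{r_\nu}$ is called tight if $|Y|=2\binom ne$; thus for $3$-designs tight means $|Y|=2n$. A $2$-$(n,k,\lambda)$ design is a set of $k$-element subsets (blocks) of an $n$-set such that any two distinct points lie in exactly $\lambda$ common blocks; it is symmetric if the number of blocks is $n$. -}

module Defs where

open import Data.Bool using (if_then_else_)
open import Data.Fin using (Fin)
open import Data.Fin.Subset using (Subset; inside; outside; ∣_∣; ∁; _∈_)
open import Data.Fin.Subset.Properties using (_⊆?_; _∈?_)
open import Data.Integer using (+_)
open import Data.List using (List; []; _∷_; _++_; map; filter; foldr; length)
open import Data.List.Membership.Propositional using () renaming (_∈_ to _∈ˡ_)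
open import Data.List.Relation.Binary.BagAndSetEquality using (_∼[_]_; set)
open import Data.List.Relation.Unary.Unique.Propositional using (Unique)
open import Data.Nat using (ℕ; zero; suc; _≤_; _≟_) renaming (_+_ to _+ⁿ_; _*_ to _*ⁿ_)
open import Data.Nat.Combinatorics using (_C_)
open import Data.Product using (_×_; ∃-syntax)
open import Data.Rational using (ℚ; 0ℚ; 1ℚ; _+_; _*_; _<_; _/_)
open import Data.Sum using (_⊎_)
import Data.Vec as Vec
open import Relation.Binary.PropositionalEquality using (_≡_; _≢_)
open import Relation.Nullary using (does)
open import Relation.Nullary.Decidable using (_×-dec_)

-- A point x of X = {0,1}ⁿ is a `Subset n`, i.e. a Boolean vector of length n.
-- As `Subset n` also serves as the type of subsets of V = Fin n, the set B_x
-- is x itself, and the number of ones of x is ∣ x ∣.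

allPoints : ∀ n → List (Subset n)
allPoints zero    = Vec.[] ∷ []
allPoints (suc n) = map (outside Vec.∷_) (allPoints n) ++ map (inside Vec.∷_) (allPoints n)

onShell : ∀ {n} → ℕ → List (Subset n) → List (Subset n)
onShell r = filter (λ x → ∣ x ∣ ≟ r)

shell : ∀ n → ℕ → List (Subset n)
shell n r = onShell r (allPoints n)

∑[_]_ : ∀ {A : Set} → List A → (A → ℚ) → ℚ
∑[ xs ] g = foldr _+_ 0ℚ (map g xs)

f : ∀ {n} → Subset n → Subset n → ℚ
f z x = if does (z ⊆? x) then 1ℚ else 0ℚ

-- The value at 0 is a convention without effect on relative designs: 1/ |X_r|
-- occurs there only as a factor of a sum over X_r, which is 0 if X_r is empty.
1/′_ : ℕ → ℚ
1/′ zero    = 0ℚ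
1/′ (suc m) = + 1 / suc m

-- A finite subset Y of X_{r₁} ∪ X_{r₂} is given by a duplicate-free list of its
-- elements.  Only the values of w on Y are ever used.
record WeightedSubset (n r₁ r₂ : ℕ) : Set where
  field
    Y          : List (Subset n)
    unique     : Unique Y
    two-shells : ∀ {y} → y ∈ˡ Y → ∣ y ∣ ≡ r₁ ⊎ ∣ y ∣ ≡ r₂
    w          : Subset n → ℚ
    positive   : ∀ {y} → y ∈ˡ Y → 0ℚ < w y

module _ {n r₁ r₂ : ℕ} (𝒴 : WeightedSubset n r₁ r₂) where
  open WeightedSubset 𝒴

  Y[_] : ℕ → List (Subset n)
  Y[ r ] = onShell r Y

  shellTerm : ℕ → Subset n → ℚ
  shellTerm r z = ((∑[ Y[ r ] ] w) * (1/′ length (shell n r))) * (∑[ shell n r ] f z)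

  record IsRelativeDesign (t : ℕ) : Set where
    field
      distinct : r₁ ≢ r₂
      balanced : ∀ j → 1 ≤ j → j ≤ t → (z : Subset n) → ∣ z ∣ ≡ j →
                 shellTerm r₁ z + shellTerm r₂ z ≡ ∑[ Y ] (λ y → w y * f z y)

  -- Tightness of relative (2e+1)-designs.
  record IsTightRelativeDesign (e : ℕ) : Set where
    field
      isRelativeDesign : IsRelativeDesign (2 *ⁿ e +ⁿ 1)
      nonempty₁        : ∃[ y ] y ∈ˡ Y[ r₁ ]
      nonempty₂        : ∃[ y ] y ∈ˡ Y[ r₂ ]
      constant₁        : ∀ {x y} → x ∈ˡ Y[ r₁ ] → y ∈ˡ Y[ r₁ ] → w x ≡ w y
      constant₂        : ∀ {x y} → x ∈ˡ Y[ r₂ ] → y ∈ˡ Y[ r₂ ] → w x ≡ w y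
      tight            : length Y ≡ 2 *ⁿ (n C e)

blocksThrough : ∀ {n} → Fin n → Fin n → List (Subset n) → List (Subset n)
blocksThrough i j = filter (λ B → (i ∈? B) ×-dec (j ∈? B))

record Is2Design (n k l : ℕ) (ℬ : List (Subset n)) : Set where
  field
    unique    : Unique ℬ
    blockSize : ∀ {B} → B ∈ˡ ℬ → ∣ B ∣ ≡ k
    balanced  : ∀ i j → i ≢ j → length (blocksThrough i j ℬ) ≡ l

record IsSymmetric2Design (n k l : ℕ) (ℬ : List (Subset n)) : Set where
  field
    is2Design : Is2Design n k l ℬ
    symmetric : length ℬ ≡ n

-- Equality as sets: the order of the lists is irrelevant.
IsComplementOf : ∀ {n} → List (Subset n) → List (Subset n) → Set
IsComplementOf 𝒞 ℬ = 𝒞 ∼[ set ] map ∁ ℬ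

{-# OPTIONS --safe #-}

-- Put u = v + 1, and for x of size 2u and y ∈ Y let m = ∣ x ∩ y ∣.  The design
-- condition for single points forces n to divide ∣Y₂∣, so ∣Y₁∣ = ∣Y₂∣ = n, and then
-- every z of size 1, 2, 3 lies in exactly n, 2u − 1, u − 1 members of Y.  These
-- three numbers determine the moments of m up to the third over Y, namely
-- ∑ (m − u)² = 2u² and ∑ (m − u)² m = 2u³.  If x ∈ Y₂, the member y = x alone
-- accounts for the whole second sum but only for half of the first, so some other
-- y ∈ Y has m = 0, and its size leaves only y = ∁ x.  If x = ∁ y₀ with y₀ ∈ Y₁, the
-- same argument with 2u − m in place of m shows that x ∈ Y₂.  Once Y₂ consists of
-- the complements of Y₁, the numbers for Y and those for Y₁ determine each other by
-- inclusion–exclusion and by counting flags.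
module Submission where

open import Algebra.Properties.CommutativeSemigroup using (interchange)
open import Data.Bool using (Bool; true; false; if_then_else_)
open import Data.Fin using (Fin; zero; suc; fromℕ<)
open import Data.Fin.Subset using (Subset; inside; outside; ∣_∣; ∁; _∩_; _∪_; ⁅_⁆; _⊆_; ⊥; ⊤) renaming (_∈_ to _∈ˢ_)
open import Data.Fin.Subset.Properties
import Data.Integer as ℤ
import Data.Integer.Properties as ℤ
open import Data.List using (List; []; _∷_; _++_; map; filter; length)
open import Data.List.Membership.Propositional using (_∈_)
open import Data.List.Membership.Propositional.Properties
  using (∈-++⁺ˡ; ∈-++⁺ʳ; ∈-++⁻; ∈-∃++; ∈-filter⁺; ∈-filter⁻; ∈-map⁺; ∈-map⁻; ∈-length)
open import Data.List.Membership.Propositional.Properties.WithK using (unique∧set⇒bag)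
open import Data.List.Properties using (++-identityʳ; length-++; length-map; map-++; map-∘)
open import Data.List.Relation.Binary.BagAndSetEquality using (∼bag⇒↭)
open import Data.List.Relation.Binary.Permutation.Propositional using (_↭_; ↭-refl; ↭-sym; ↭-trans)
import Data.List.Relation.Binary.Permutation.Propositional.Properties as ↭
import Data.List.Relation.Unary.All as All
open import Data.List.Relation.Unary.AllPairs using ([]; _∷_)
open import Data.List.Relation.Unary.Any using (here; there)
open import Data.List.Relation.Unary.Unique.Propositional using (Unique)
import Data.List.Relation.Unary.Unique.Propositional.Properties as Unique
open import Data.Nat
open import Data.Nat.Combinatorics using (_C_; nCk+nC[k+1]≡[n+1]C[k+1]; nC1≡n)
open import Data.Nat.Divisibility using (_∣_; divides; ∣m+n∣m⇒∣n)
open import Data.Nat.ListAction using (sum)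
open import Data.Nat.ListAction.Properties using (sum-++; sum-↭)
open import Data.Nat.Properties
open import Data.Nat.Tactic.RingSolver using (solve-∀)
open import Data.Product using (_×_; _,_; ∃-syntax; proj₁; proj₂)
open import Data.Rational as ℚ using (ℚ; 1ℚ; ↥_; toℚᵘ)
open import Data.Rational.Literals using (fromℤ)
import Data.Rational.Properties as ℚ
open import Data.Rational.Solver using (module +-*-Solver)
open import Data.Rational.Unnormalised using (mkℚᵘ; *≡*)
import Data.Rational.Unnormalised.Properties as ℚᵘ
open import Data.Sum using (_⊎_; inj₁; inj₂)
open import Data.Vec using ([]; _∷_; here)
open import Function using (_∘_)
open import Function.Bundles using (_⇔_; mk⇔)
open import Level using (0ℓ)
open import Relation.Binary.PropositionalEquality hiding ([_])
open import Relation.Nullary using (yes; no; does; contradiction)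
open import Relation.Nullary.Decidable using (dec-true; dec-false; _×-dec_; does-⇔; decidable-stable)
open import Relation.Unary using (Pred; Decidable)
open import Defs
open ≡-Reasoning

-- Sums over lists

-- The weight (m - u)² is read off from the configuration to be found. When Y consists of the blocks
-- of a symmetric 2-(4u - 1, 2u, u) design and their complements, a block x of size 2u meets itself
-- in 2u points, its complement in none and every other member in exactly u. So (m - u)² lives on
-- the pair x, `∁ x`, with value u² at each, and a further factor m or 2u - m singles out one of the
-- two. Both products are nonnegative and cubic in m, and the conditions on sets of size at most 3
-- determine the sum over Y of any cubic in m. These sums are therefore known before anything is
-- known about Y, and nonnegativity forces the partner of x to exist.
--
-- The design condition equates rational averages, while everything counted is a natural number.
-- Each condition is therefore multiplied by a common denominator, and negative terms are moved to
-- the other side of an equation.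

private variable
  A B : Set
  n : ℕ

∑ : List A → (A → ℕ) → ℕ
∑ xs g = sum (map g xs)

∑-cong-∈ : (xs : List A) {g h : A → ℕ} → (∀ {x} → x ∈ xs → g x ≡ h x) → ∑ xs g ≡ ∑ xs h
∑-cong-∈ []       e = refl
∑-cong-∈ (x ∷ xs) e = cong₂ _+_ (e (here refl)) (∑-cong-∈ xs (e ∘ there))

∑-cong : (xs : List A) {g h : A → ℕ} → (∀ x → g x ≡ h x) → ∑ xs g ≡ ∑ xs h
∑-cong xs e = ∑-cong-∈ xs (λ {x} _ → e x)

∑-+ : (xs : List A) (g h : A → ℕ) → ∑ xs (λ x → g x + h x) ≡ ∑ xs g + ∑ xs h
∑-+ []       g h = refl
∑-+ (x ∷ xs) g h = trans (cong (g x + h x +_) (∑-+ xs g h)) (interchange +-commutativeSemigroup (g x) (h x) _ _)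

∑-*ˡ : (xs : List A) (c : ℕ) (g : A → ℕ) → ∑ xs (λ x → c * g x) ≡ c * ∑ xs g
∑-*ˡ []       c g = sym (*-zeroʳ c)
∑-*ˡ (x ∷ xs) c g = trans (cong (c * g x +_) (∑-*ˡ xs c g)) (sym (*-distribˡ-+ c (g x) _))

∑-*ʳ : (xs : List A) (c : ℕ) (g : A → ℕ) → ∑ xs (λ x → g x * c) ≡ ∑ xs g * c
∑-*ʳ xs c g = begin
  ∑ xs (λ x → g x * c) ≡⟨ ∑-cong xs (λ x → *-comm (g x) c) ⟩
  ∑ xs (λ x → c * g x) ≡⟨ ∑-*ˡ xs c g ⟩
  c * ∑ xs g           ≡⟨ *-comm c _ ⟩
  ∑ xs g * c           ∎

∑-const : (xs : List A) (c : ℕ) → ∑ xs (λ _ → c) ≡ length xs * c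
∑-const []       c = refl
∑-const (x ∷ xs) c = cong (c +_) (∑-const xs c)

∑-zero : (xs : List A) → ∑ xs (λ _ → 0) ≡ 0
∑-zero xs = trans (∑-const xs 0) (*-zeroʳ (length xs))

∑-one : (xs : List A) → ∑ xs (λ _ → 1) ≡ length xs
∑-one xs = trans (∑-const xs 1) (*-identityʳ _)

∑-swap : (xs : List A) (ys : List B) (g : A → B → ℕ) →
         ∑ xs (λ x → ∑ ys (g x)) ≡ ∑ ys (λ y → ∑ xs (λ x → g x y))
∑-swap []       ys g = sym (∑-zero ys)
∑-swap (x ∷ xs) ys g = trans (cong (∑ ys (g x) +_) (∑-swap xs ys g)) (sym (∑-+ ys (g x) _))

∑-++ : (xs ys : List A) (g : A → ℕ) → ∑ (xs ++ ys) g ≡ ∑ xs g + ∑ ys g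
∑-++ xs ys g = trans (cong sum (map-++ g xs ys)) (sum-++ (map g xs) (map g ys))

∑-map : (k : A → B) (xs : List A) (g : B → ℕ) → ∑ (map k xs) g ≡ ∑ xs (g ∘ k)
∑-map k xs g = cong sum (sym (map-∘ xs))

∑-↭ : {xs ys : List A} (g : A → ℕ) → xs ↭ ys → ∑ xs g ≡ ∑ ys g
∑-↭ g p = sum-↭ (↭.map⁺ g p)

⟦_⟧ : Bool → ℕ
⟦ b ⟧ = if b then 1 else 0

∑-filter : {P : Pred A 0ℓ} (P? : Decidable P) (xs : List A) (g : A → ℕ) →
           ∑ (filter P? xs) g ≡ ∑ xs (λ x → ⟦ does (P? x) ⟧ * g x)
∑-filter P? []       g = refl
∑-filter P? (x ∷ xs) g with does (P? x)
... | true  = cong₂ _+_ (sym (+-identityʳ (g x))) (∑-filter P? xs g)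
... | false = ∑-filter P? xs g

[_⊑_] : Subset n → Subset n → ℕ
[ z ⊑ x ] = ⟦ does (z ⊆? x) ⟧

[_≐_] : ℕ → ℕ → ℕ
[ a ≐ b ] = ⟦ does (a ≟ b) ⟧

⊑-yes : (z x : Subset n) → z ⊆ x → [ z ⊑ x ] ≡ 1
⊑-yes z x z⊆x = cong ⟦_⟧ (dec-true (z ⊆? x) z⊆x)

≐-refl : ∀ a → [ a ≐ a ] ≡ 1
≐-refl a = cong ⟦_⟧ (dec-true (a ≟ a) refl)

≐-no : ∀ {a b} → a ≢ b → [ a ≐ b ] ≡ 0
≐-no {a} {b} a≢b = cong ⟦_⟧ (dec-false (a ≟ b) a≢b)

-- ∑ᵢ (d C i) * φ i
binomialSum : ℕ → (ℕ → ℕ) → ℕ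
binomialSum zero    φ = φ 0
binomialSum (suc d) φ = binomialSum d φ + binomialSum d (φ ∘ suc)

binomialSum-cong : ∀ d {φ ψ : ℕ → ℕ} → (∀ i → φ i ≡ ψ i) → binomialSum d φ ≡ binomialSum d ψ
binomialSum-cong zero    e = e 0
binomialSum-cong (suc d) e = cong₂ _+_ (binomialSum-cong d e) (binomialSum-cong d (e ∘ suc))

binomialSum-+ : ∀ d (φ ψ : ℕ → ℕ) →
                binomialSum d (λ i → φ i + ψ i) ≡ binomialSum d φ + binomialSum d ψ
binomialSum-+ zero    φ ψ = refl
binomialSum-+ (suc d) φ ψ =
  trans (cong₂ _+_ (binomialSum-+ d φ ψ) (binomialSum-+ d (φ ∘ suc) (ψ ∘ suc)))
        (interchange +-commutativeSemigroup (binomialSum d φ) (binomialSum d ψ) _ _)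

binomialSum-* : ∀ d c (φ : ℕ → ℕ) → binomialSum d (λ i → c * φ i) ≡ c * binomialSum d φ
binomialSum-* zero    c φ = refl
binomialSum-* (suc d) c φ =
  trans (cong₂ _+_ (binomialSum-* d c φ) (binomialSum-* d c (φ ∘ suc)))
        (sym (*-distribˡ-+ c (binomialSum d φ) _))

binomialSum-zero : ∀ d → binomialSum d (λ _ → 0) ≡ 0
binomialSum-zero d = binomialSum-* d 0 (λ _ → 0)

-- Absorption, i (d + 1 choose i) = (d + 1) (d choose i - 1), summed against `φ`. It is what relates
-- the shell counts for sets of size j + 1 to those of size j.
binomialSum-absorb : ∀ d (φ : ℕ → ℕ) →
  binomialSum (suc d) (λ i → i * φ i) ≡ suc d * binomialSum d (φ ∘ suc)
binomialSum-absorb zero    φ = refl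
binomialSum-absorb (suc d) φ = begin
  binomialSum (suc d) (λ i → i * φ i) + binomialSum (suc d) (λ i → φ (suc i) + i * φ (suc i))
    ≡⟨ cong₂ _+_ (binomialSum-absorb d φ)
         (trans (binomialSum-+ (suc d) (φ ∘ suc) (λ i → i * φ (suc i)))
                (cong (binomialSum (suc d) (φ ∘ suc) +_) (binomialSum-absorb d (φ ∘ suc)))) ⟩
  suc d * a + (a + b + suc d * b)
    ≡⟨ collect d a b ⟩
  suc (suc d) * (a + b) ∎
  where
  a = binomialSum d (φ ∘ suc)
  b = binomialSum d (λ i → φ (suc (suc i)))
  collect : ∀ d a b → suc d * a + (a + b + suc d * b) ≡ suc (suc d) * (a + b)
  collect = solve-∀

binomialSum-C : ∀ d k → binomialSum d (λ i → [ i ≐ k ]) ≡ d C k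
binomialSum-C zero    zero    = refl
binomialSum-C zero    (suc k) = refl
binomialSum-C (suc d) zero    = cong₂ _+_ (binomialSum-C d 0) (binomialSum-zero d)
binomialSum-C (suc d) (suc k) = begin
  binomialSum d (λ i → [ i ≐ suc k ]) + binomialSum d (λ i → [ i ≐ k ])
    ≡⟨ cong₂ _+_ (binomialSum-C d (suc k)) (binomialSum-C d k) ⟩
  d C suc k + d C k ≡⟨ +-comm (d C suc k) _ ⟩
  d C k + d C suc k ≡⟨ nCk+nC[k+1]≡[n+1]C[k+1] d k ⟩
  suc d C suc k     ∎

-- A coordinate on which `z` and `w` agree is forced, one in `w` only is free and gives a Pascal
-- step, and one in `z` only empties the interval. `φ` is arbitrary because taking an element into
-- `x` shifts it to `φ ∘ suc`.
∑-interval : (z w : Subset n) (φ : ℕ → ℕ) →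
  ∑ (allPoints n) (λ x → [ z ⊑ x ] * [ x ⊑ w ] * φ ∣ x ∣) ≡
  [ z ⊑ w ] * binomialSum (∣ w ∣ ∸ ∣ z ∣) (λ i → φ (∣ z ∣ + i))
∑-interval []      []      φ = +-identityʳ _
∑-interval {suc n} z w φ = trans (split F) (cases z w)
  where
  F : Subset (suc n) → ℕ
  F x = [ z ⊑ x ] * [ x ⊑ w ] * φ ∣ x ∣
  split : (G : Subset (suc n) → ℕ) →
    ∑ (allPoints (suc n)) G ≡
    ∑ (allPoints n) (G ∘ (outside ∷_)) + ∑ (allPoints n) (G ∘ (inside ∷_))
  split G = trans (∑-++ (map (outside ∷_) (allPoints n)) _ G)
    (cong₂ _+_ (∑-map (outside ∷_) (allPoints n) G) (∑-map (inside ∷_) (allPoints n) G))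
  vanishʳ : ∀ {z x : Subset n} {c} → [ z ⊑ x ] * 0 * c ≡ 0
  vanishʳ {z} {x} {c} = cong (_* c) (*-zeroʳ [ z ⊑ x ])
  cases : (z w : Subset (suc n)) →
    ∑ (allPoints n) (λ x → [ z ⊑ outside ∷ x ] * [ outside ∷ x ⊑ w ] * φ ∣ x ∣) +
    ∑ (allPoints n) (λ x → [ z ⊑ inside ∷ x ] * [ inside ∷ x ⊑ w ] * φ (suc ∣ x ∣))
    ≡ [ z ⊑ w ] * binomialSum (∣ w ∣ ∸ ∣ z ∣) (λ i → φ (∣ z ∣ + i))
  cases (outside ∷ z) (outside ∷ w) =
    trans (cong₂ _+_ (∑-interval z w φ)
             (trans (∑-cong (allPoints n) (λ x → vanishʳ {z} {x})) (∑-zero (allPoints n))))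
          (+-identityʳ _)
  cases (outside ∷ z) (inside ∷ w) =
    trans (cong₂ _+_ (∑-interval z w φ) (∑-interval z w (φ ∘ suc))) pascal
    where
    pascal : [ z ⊑ w ] * binomialSum (∣ w ∣ ∸ ∣ z ∣) (λ i → φ (∣ z ∣ + i)) +
             [ z ⊑ w ] * binomialSum (∣ w ∣ ∸ ∣ z ∣) (λ i → φ (suc (∣ z ∣ + i))) ≡
             [ z ⊑ w ] * binomialSum (suc ∣ w ∣ ∸ ∣ z ∣) (λ i → φ (∣ z ∣ + i))
    -- Moving `suc` out of the truncated difference requires ∣ z ∣ ≤ ∣ w ∣, which the inclusion
    -- supplies; without inclusion both sides are 0.
    pascal with z ⊆? w
    ... | no _    = refl
    ... | yes z⊆w rewrite +-∸-assoc 1 (p⊆q⇒∣p∣≤∣q∣ z⊆w) =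
      trans (sym (*-distribˡ-+ 1 (binomialSum (∣ w ∣ ∸ ∣ z ∣) (λ i → φ (∣ z ∣ + i))) _))
        (cong (λ t → 1 * (binomialSum (∣ w ∣ ∸ ∣ z ∣) (λ i → φ (∣ z ∣ + i)) + t))
          (binomialSum-cong (∣ w ∣ ∸ ∣ z ∣) (λ i → cong φ (sym (+-suc ∣ z ∣ i)))))
  cases (inside ∷ z) (outside ∷ w) =
    cong₂ _+_ (∑-zero (allPoints n))
      (trans (∑-cong (allPoints n) (λ x → vanishʳ {z} {x})) (∑-zero (allPoints n)))
  cases (inside ∷ z) (inside ∷ w) =
    cong₂ _+_ (∑-zero (allPoints n)) (∑-interval z w (φ ∘ suc))

-- Degrees and double counting

degree : List (Subset n) → Subset n → ℕ
degree Ys z = ∑ Ys (λ y → [ z ⊑ y ])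

⊑-∩ : (z x y : Subset n) → [ z ⊑ x ∩ y ] ≡ [ z ⊑ x ] * [ z ⊑ y ]
⊑-∩ []            []            []            = refl
⊑-∩ (outside ∷ z) (_ ∷ x)       (_ ∷ y)       = ⊑-∩ z x y
⊑-∩ (inside ∷ z)  (outside ∷ x) (_ ∷ y)       = refl
⊑-∩ (inside ∷ z)  (inside ∷ x)  (outside ∷ y) = sym (*-zeroʳ [ z ⊑ x ])
⊑-∩ (inside ∷ z)  (inside ∷ x)  (inside ∷ y)  = ⊑-∩ z x y

+-≐ : ∀ a b c → [ a + b ≐ a + c ] ≡ [ b ≐ c ]
+-≐ zero    b c = refl
+-≐ (suc a) b c = +-≐ a b c

∑-interval-C : (z w : Subset n) (k : ℕ) →
  ∑ (allPoints n) (λ x → [ z ⊑ x ] * [ x ⊑ w ] * [ ∣ x ∣ ≐ ∣ z ∣ + k ]) ≡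
  [ z ⊑ w ] * ((∣ w ∣ ∸ ∣ z ∣) C k)
∑-interval-C z w k = trans (∑-interval z w (λ m → [ m ≐ ∣ z ∣ + k ]))
  (cong ([ z ⊑ w ] *_) (trans (binomialSum-cong (∣ w ∣ ∸ ∣ z ∣) (λ i → +-≐ ∣ z ∣ i k)) (binomialSum-C (∣ w ∣ ∸ ∣ z ∣) k)))

-- Counts the pairs (y, z′) with z ⊆ z′ ⊆ x ∩ y and ∣ z′ ∣ = ∣ z ∣ + k in two ways.
∑-extension : (Ys : List (Subset n)) (z x : Subset n) (k : ℕ) {c : ℕ} → z ⊆ x →
  (∀ z′ → ∣ z′ ∣ ≡ ∣ z ∣ + k → degree Ys z′ ≡ c) →
  ∑ Ys (λ y → [ z ⊑ y ] * ((∣ x ∩ y ∣ ∸ ∣ z ∣) C k)) ≡ ((∣ x ∣ ∸ ∣ z ∣) C k) * c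
∑-extension {n} Ys z x k {c} z⊆x deg = begin
  ∑ Ys (λ y → [ z ⊑ y ] * ((∣ x ∩ y ∣ ∸ ∣ z ∣) C k))
    ≡⟨ ∑-cong Ys (λ y → cong (_* ((∣ x ∩ y ∣ ∸ ∣ z ∣) C k)) (sym (z⊑x∩y y))) ⟩
  ∑ Ys (λ y → [ z ⊑ x ∩ y ] * ((∣ x ∩ y ∣ ∸ ∣ z ∣) C k))
    ≡⟨ ∑-cong Ys (λ y → sym (∑-interval-C z (x ∩ y) k)) ⟩
  ∑ Ys (λ y → ∑ P (λ z′ → [ z ⊑ z′ ] * [ z′ ⊑ x ∩ y ] * δ z′))
    ≡⟨ ∑-swap Ys P _ ⟩
  ∑ P (λ z′ → ∑ Ys (λ y → [ z ⊑ z′ ] * [ z′ ⊑ x ∩ y ] * δ z′))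
    ≡⟨ ∑-cong P inner ⟩
  ∑ P (λ z′ → [ z ⊑ z′ ] * [ z′ ⊑ x ] * δ z′ * c)
    ≡⟨ ∑-*ʳ P c _ ⟩
  ∑ P (λ z′ → [ z ⊑ z′ ] * [ z′ ⊑ x ] * δ z′) * c
    ≡⟨ cong (_* c) (∑-interval-C z x k) ⟩
  [ z ⊑ x ] * ((∣ x ∣ ∸ ∣ z ∣) C k) * c
    ≡⟨ cong (λ t → t * ((∣ x ∣ ∸ ∣ z ∣) C k) * c) (⊑-yes z x z⊆x) ⟩
  1 * ((∣ x ∣ ∸ ∣ z ∣) C k) * c
    ≡⟨ cong (_* c) (*-identityˡ ((∣ x ∣ ∸ ∣ z ∣) C k)) ⟩
  ((∣ x ∣ ∸ ∣ z ∣) C k) * c ∎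
  where
  P = allPoints n
  δ : Subset n → ℕ
  δ z′ = [ ∣ z′ ∣ ≐ ∣ z ∣ + k ]
  z⊑x∩y : ∀ y → [ z ⊑ x ∩ y ] ≡ [ z ⊑ y ]
  z⊑x∩y y = trans (⊑-∩ z x y) (trans (cong (_* [ z ⊑ y ]) (⊑-yes z x z⊆x)) (*-identityˡ _))
  constant : ∀ z′ → δ z′ * degree Ys z′ ≡ δ z′ * c
  constant z′ with ∣ z′ ∣ ≟ ∣ z ∣ + k
  ... | yes e = cong (δ z′ *_) (deg z′ e)
  ... | no ne rewrite ≐-no ne = refl
  rearrange : ∀ a b c d → a * (b * c) * d ≡ a * b * d * c
  rearrange = solve-∀
  inner : ∀ z′ → ∑ Ys (λ y → [ z ⊑ z′ ] * [ z′ ⊑ x ∩ y ] * δ z′) ≡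
                 [ z ⊑ z′ ] * [ z′ ⊑ x ] * δ z′ * c
  inner z′ = begin
    ∑ Ys (λ y → [ z ⊑ z′ ] * [ z′ ⊑ x ∩ y ] * δ z′)
      ≡⟨ ∑-cong Ys (λ y → trans (cong (λ t → [ z ⊑ z′ ] * t * δ z′) (⊑-∩ z′ x y))
                                (rearrange [ z ⊑ z′ ] [ z′ ⊑ x ] [ z′ ⊑ y ] (δ z′))) ⟩
    ∑ Ys (λ y → [ z ⊑ z′ ] * [ z′ ⊑ x ] * δ z′ * [ z′ ⊑ y ])
      ≡⟨ ∑-*ˡ Ys ([ z ⊑ z′ ] * [ z′ ⊑ x ] * δ z′) (λ y → [ z′ ⊑ y ]) ⟩
    [ z ⊑ z′ ] * [ z′ ⊑ x ] * δ z′ * degree Ys z′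
      ≡⟨ *-assoc ([ z ⊑ z′ ] * [ z′ ⊑ x ]) (δ z′) _ ⟩
    [ z ⊑ z′ ] * [ z′ ⊑ x ] * (δ z′ * degree Ys z′)
      ≡⟨ cong ([ z ⊑ z′ ] * [ z′ ⊑ x ] *_) (constant z′) ⟩
    [ z ⊑ z′ ] * [ z′ ⊑ x ] * (δ z′ * c)
      ≡⟨ sym (*-assoc ([ z ⊑ z′ ] * [ z′ ⊑ x ]) (δ z′) c) ⟩
    [ z ⊑ z′ ] * [ z′ ⊑ x ] * δ z′ * c ∎

-- The case `z = ⊥` of `∑-extension`: pairs of a member y and a k-subset of `x ∩ y`. Degrees thus
-- become moments of the intersection sizes.
∑-moment : (Ys : List (Subset n)) (x : Subset n) (k : ℕ) {c : ℕ} →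
  (∀ z → ∣ z ∣ ≡ k → degree Ys z ≡ c) →
  ∑ Ys (λ y → ∣ x ∩ y ∣ C k) ≡ (∣ x ∣ C k) * c
∑-moment {n} Ys x k {c} deg = begin
  ∑ Ys (λ y → ∣ x ∩ y ∣ C k)
    ≡⟨ ∑-cong Ys (λ y → sym (trans (cong₂ _*_ (⊑-yes ⊥ y ⊥⊆) (cong (λ t → (∣ x ∩ y ∣ ∸ t) C k) (∣⊥∣≡0 n))) (*-identityˡ (∣ x ∩ y ∣ C k)))) ⟩
  ∑ Ys (λ y → [ ⊥ ⊑ y ] * ((∣ x ∩ y ∣ ∸ ∣ ⊥ {n} ∣) C k))
    ≡⟨ ∑-extension Ys ⊥ x k ⊥⊆ (λ z e → deg z (trans e (cong (_+ k) (∣⊥∣≡0 n)))) ⟩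
  ((∣ x ∣ ∸ ∣ ⊥ {n} ∣) C k) * c ≡⟨ cong (λ t → ((∣ x ∣ ∸ t) C k) * c) (∣⊥∣≡0 n) ⟩
  (∣ x ∣ C k) * c ∎

∑-∣∩∣ : (Ys : List (Subset n)) (x : Subset n) {c : ℕ} →
  (∀ z → ∣ z ∣ ≡ 1 → degree Ys z ≡ c) → ∑ Ys (λ y → ∣ x ∩ y ∣) ≡ ∣ x ∣ * c
∑-∣∩∣ Ys x {c} deg = begin
  ∑ Ys (λ y → ∣ x ∩ y ∣)     ≡⟨ ∑-cong Ys (λ y → sym (nC1≡n ∣ x ∩ y ∣)) ⟩
  ∑ Ys (λ y → ∣ x ∩ y ∣ C 1) ≡⟨ ∑-moment Ys x 1 deg ⟩
  (∣ x ∣ C 1) * c            ≡⟨ cong (_* c) (nC1≡n ∣ x ∣) ⟩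
  ∣ x ∣ * c                  ∎

-- The case `x = ⊤`, `k = 1` of `∑-extension`: flags, i.e. members through `z` with one further
-- point marked.
∑-neighbours : (Ys : List (Subset n)) (z : Subset n) {c : ℕ} →
  (∀ z′ → ∣ z′ ∣ ≡ ∣ z ∣ + 1 → degree Ys z′ ≡ c) →
  ∑ Ys (λ y → [ z ⊑ y ] * (∣ y ∣ ∸ ∣ z ∣)) ≡ (n ∸ ∣ z ∣) * c
∑-neighbours {n} Ys z {c} deg = begin
  ∑ Ys (λ y → [ z ⊑ y ] * (∣ y ∣ ∸ ∣ z ∣))
    ≡⟨ ∑-cong Ys (λ y → cong ([ z ⊑ y ] *_) (sym (trans (nC1≡n (∣ ⊤ ∩ y ∣ ∸ ∣ z ∣)) (cong (λ t → ∣ t ∣ ∸ ∣ z ∣) (∩-identityˡ y))))) ⟩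
  ∑ Ys (λ y → [ z ⊑ y ] * ((∣ ⊤ ∩ y ∣ ∸ ∣ z ∣) C 1))
    ≡⟨ ∑-extension Ys z ⊤ 1 ⊆⊤ deg ⟩
  ((∣ ⊤ {n} ∣ ∸ ∣ z ∣) C 1) * c
    ≡⟨ cong (_* c) (trans (nC1≡n (∣ ⊤ {n} ∣ ∸ ∣ z ∣)) (cong (_∸ ∣ z ∣) (∣⊤∣≡n n))) ⟩
  (n ∸ ∣ z ∣) * c ∎

-- The binomial coefficient (n - j choose r - j), to be read as 0 for r < j. With `r ∸ j` as lower
-- index it would be 1 there, hence the sum over i.
shellDegree : ℕ → ℕ → ℕ → ℕ
shellDegree n r j = binomialSum (n ∸ j) (λ i → [ j + i ≐ r ])

degree-shell : ∀ n r (z : Subset n) → degree (shell n r) z ≡ shellDegree n r ∣ z ∣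
degree-shell n r z = begin
  degree (shell n r) z
    ≡⟨ ∑-filter (λ x → ∣ x ∣ ≟ r) (allPoints n) (λ x → [ z ⊑ x ]) ⟩
  ∑ (allPoints n) (λ x → [ ∣ x ∣ ≐ r ] * [ z ⊑ x ])
    ≡⟨ ∑-cong (allPoints n) (λ x → trans (*-comm [ ∣ x ∣ ≐ r ] [ z ⊑ x ])
         (cong (_* [ ∣ x ∣ ≐ r ]) (sym (trans (cong ([ z ⊑ x ] *_) (⊑-yes x ⊤ ⊆⊤)) (*-identityʳ [ z ⊑ x ]))))) ⟩
  ∑ (allPoints n) (λ x → [ z ⊑ x ] * [ x ⊑ ⊤ ] * [ ∣ x ∣ ≐ r ])
    ≡⟨ ∑-interval z ⊤ (λ m → [ m ≐ r ]) ⟩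
  [ z ⊑ ⊤ ] * binomialSum (∣ ⊤ {n} ∣ ∸ ∣ z ∣) (λ i → [ ∣ z ∣ + i ≐ r ])
    ≡⟨ cong₂ (λ a b → a * binomialSum (b ∸ ∣ z ∣) (λ i → [ ∣ z ∣ + i ≐ r ])) (⊑-yes z ⊤ ⊆⊤) (∣⊤∣≡n n) ⟩
  1 * shellDegree n r ∣ z ∣ ≡⟨ *-identityˡ _ ⟩
  shellDegree n r ∣ z ∣ ∎

length-shell : ∀ n r → length (shell n r) ≡ shellDegree n r 0
length-shell n r = begin
  length (shell n r)            ≡⟨ sym (∑-one (shell n r)) ⟩
  ∑ (shell n r) (λ _ → 1)       ≡⟨ ∑-cong (shell n r) (λ x → sym (⊑-yes ⊥ x ⊥⊆)) ⟩
  degree (shell n r) ⊥          ≡⟨ degree-shell n r ⊥ ⟩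
  shellDegree n r ∣ ⊥ {n} ∣     ≡⟨ cong (shellDegree n r) (∣⊥∣≡0 n) ⟩
  shellDegree n r 0             ∎

-- Absorption at i = r - j, the only index at which the indicator is nonzero. For r ≤ j both sides
-- are 0.
shellDegree-suc : ∀ {n m} r j → n ∸ j ≡ suc m →
                  suc m * shellDegree n r (suc j) ≡ (r ∸ j) * shellDegree n r j
shellDegree-suc {n} {m} r j n∸j = begin
  suc m * binomialSum (n ∸ suc j) (λ i → [ suc (j + i) ≐ r ])
    ≡⟨ cong (suc m *_) (trans (cong (λ t → binomialSum t (λ i → [ suc (j + i) ≐ r ])) n∸sucj)
         (binomialSum-cong m (λ i → cong [_≐ r ] (sym (+-suc j i))))) ⟩
  suc m * binomialSum m (λ i → [ j + suc i ≐ r ])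
    ≡⟨ sym (binomialSum-absorb m (λ i → [ j + i ≐ r ])) ⟩
  binomialSum (suc m) (λ i → i * [ j + i ≐ r ])
    ≡⟨ binomialSum-cong (suc m) index ⟩
  binomialSum (suc m) (λ i → (r ∸ j) * [ j + i ≐ r ])
    ≡⟨ binomialSum-* (suc m) (r ∸ j) _ ⟩
  (r ∸ j) * binomialSum (suc m) (λ i → [ j + i ≐ r ])
    ≡⟨ cong (λ t → (r ∸ j) * binomialSum t (λ i → [ j + i ≐ r ])) (sym n∸j) ⟩
  (r ∸ j) * shellDegree n r j ∎
  where
  n∸sucj : n ∸ suc j ≡ m
  n∸sucj = trans (sym (pred[m∸n]≡m∸[1+n] n j)) (cong pred n∸j)
  index : ∀ i → i * [ j + i ≐ r ] ≡ (r ∸ j) * [ j + i ≐ r ]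
  index i with j + i ≟ r
  ... | yes refl = cong (_* [ j + i ≐ j + i ]) (sym (m+n∸m≡n j i))
  ... | no ne rewrite ≐-no ne = trans (*-zeroʳ i) (sym (*-zeroʳ (r ∸ j)))

shellDegree>0 : ∀ {n r} → r ≤ n → 0 < shellDegree n r 0
shellDegree>0 {zero}  z≤n       = s≤s z≤n
shellDegree>0 {suc n} z≤n       = <-≤-trans (shellDegree>0 {n} z≤n) (m≤m+n _ _)
shellDegree>0         (s≤s r≤n) = <-≤-trans (shellDegree>0 r≤n) (m≤n+m _ _)

-- With `⊑-∁-∣∩∣` this makes containment in y or in `∁ y` a function of ∣ z ∩ y ∣, so that
-- inclusion-exclusion for ∣ z ∣ ≤ 3 is a check of at most four values.
⊑-∣∩∣ : (z y : Subset n) → [ z ⊑ y ] ≡ [ ∣ z ∩ y ∣ ≐ ∣ z ∣ ]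
⊑-∣∩∣ []            []            = refl
⊑-∣∩∣ (outside ∷ z) (_ ∷ y)       = ⊑-∣∩∣ z y
⊑-∣∩∣ (inside ∷ z)  (outside ∷ y) = sym (≐-no (<⇒≢ (s≤s (∣p∩q∣≤∣p∣ z y))))
⊑-∣∩∣ (inside ∷ z)  (inside ∷ y)  = ⊑-∣∩∣ z y

⊑-∁-∣∩∣ : (z y : Subset n) → [ z ⊑ ∁ y ] ≡ [ ∣ z ∩ y ∣ ≐ 0 ]
⊑-∁-∣∩∣ []            []            = refl
⊑-∁-∣∩∣ (outside ∷ z) (_ ∷ y)       = ⊑-∁-∣∩∣ z y
⊑-∁-∣∩∣ (inside ∷ z)  (outside ∷ y) = ⊑-∁-∣∩∣ z y
⊑-∁-∣∩∣ (inside ∷ z)  (inside ∷ y)  = refl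

-- The term at `x` exhausts the sum of p q, so p q vanishes at every other entry. As `p x` falls
-- short of the sum of p, some other entry has positive p, and there q is 0.
∃-zero : {xs : List A} {x : A} (p q : A → ℕ) → x ∈ xs →
         p x < ∑ xs p → ∑ xs (λ y → p y * q y) ≤ p x * q x → ∃[ y ] y ∈ xs × q y ≡ 0
∃-zero {xs = x ∷ xs} p q (here refl) p< pq≤ with rest xs (positive (p x) p<) (null pq≤)
  where
  positive : ∀ a {b} → a < a + b → 0 < b
  positive a {b} lt = +-cancelˡ-< a 0 b (subst (_< a + b) (sym (+-identityʳ a)) lt)
  null : ∀ {a b} → a + b ≤ a → b ≡ 0
  null {a} {b} le = n≤0⇒n≡0 (+-cancelˡ-≤ a b 0 (subst (a + b ≤_) (sym (+-identityʳ a)) le))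
  rest : ∀ ys → 0 < ∑ ys p → ∑ ys (λ y → p y * q y) ≡ 0 → ∃[ y ] y ∈ ys × q y ≡ 0
  rest (y ∷ ys) 0< pq≡0 with p y in py
  ... | suc _ = y , here refl , m+n≡0⇒m≡0 (q y) (m+n≡0⇒m≡0 _ pq≡0)
  ... | zero with rest ys 0< pq≡0
  ...   | y′ , y′∈ , e = y′ , there y′∈ , e
... | y , y∈ , e = y , there y∈ , e
∃-zero {xs = x′ ∷ xs} {x} p q (there x∈) p< pq≤ with p x′ in px′
... | zero with ∃-zero p q x∈ p< pq≤
...   | y , y∈ , e = y , there y∈ , e
∃-zero {xs = x′ ∷ xs} {x} p q (there x∈) p< pq≤ | suc _ =
  x′ , here refl , m+n≡0⇒m≡0 (q x′) (n≤0⇒n≡0 (+-cancelʳ-≤ _ _ 0 (≤-trans pq≤ (single x∈))))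
  where
  single : ∀ {xs} → x ∈ xs → p x * q x ≤ ∑ xs (λ y → p y * q y)
  single (here refl) = m≤m+n _ _
  single (there x∈)  = ≤-trans (single x∈) (m≤n+m _ _)

-- Rational sums of natural numbers

-- `fromℤ` stores the denominator 1 literally, so no gcd is computed and injectivity is read off the
-- numerators.
ι : ℕ → ℚ
ι k = fromℤ (ℤ.+ k)

ι-+ : ∀ a b → ι (a + b) ≡ ι a ℚ.+ ι b
ι-+ a b = ℚ.toℚᵘ-injective (ℚᵘ.≃-sym (ℚᵘ.≃-trans (ℚ.toℚᵘ-homo-+ (ι a) (ι b))
  (*≡* (cong (ℤ._* ℤ.1ℤ) (cong₂ ℤ._+_ (ℤ.*-identityʳ (ℤ.+ a)) (ℤ.*-identityʳ (ℤ.+ b)))))))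

ι-* : ∀ a b → ι (a * b) ≡ ι a ℚ.* ι b
ι-* a b = ℚ.toℚᵘ-injective (ℚᵘ.≃-sym (ℚᵘ.≃-trans (ℚ.toℚᵘ-homo-* (ι a) (ι b))
  (*≡* (cong (ℤ._* ℤ.1ℤ) (sym (ℤ.pos-* a b))))))

ι-injective : ∀ {a b} → ι a ≡ ι b → a ≡ b
ι-injective e = ℤ.+-injective (cong ↥_ e)

ι-inverse : ∀ {k} → 0 < k → ι k ℚ.* (1/′ k) ≡ 1ℚ
ι-inverse {suc k} _ = ℚ.toℚᵘ-injective (ℚᵘ.≃-trans (ℚ.toℚᵘ-homo-* (ι (suc k)) (1/′ suc k))
  (ℚᵘ.≃-trans (ℚᵘ.*-congˡ {toℚᵘ (ι (suc k))} (ℚ.toℚᵘ-fromℚᵘ (mkℚᵘ (ℤ.+ 1) k)))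
    (ℚᵘ.*-inverseʳ (mkℚᵘ (ℤ.+ suc k) 0))))

ι-*-cancelˡ : ∀ d {p q} → 0 < d → ι d ℚ.* p ≡ ι d ℚ.* q → p ≡ q
ι-*-cancelˡ d {p} {q} 0<d e = trans (sym (inv p)) (trans (cong (1/′ d ℚ.*_) e) (inv q))
  where
  inv : ∀ p → 1/′ d ℚ.* (ι d ℚ.* p) ≡ p
  inv p = trans (sym (ℚ.*-assoc (1/′ d) (ι d) p))
    (trans (cong (ℚ._* p) (trans (ℚ.*-comm (1/′ d) (ι d)) (ι-inverse 0<d))) (ℚ.*-identityˡ p))

∑-ι : (xs : List A) {g : A → ℚ} {h : A → ℕ} → (∀ {x} → x ∈ xs → g x ≡ ι (h x)) →
      ∑[ xs ] g ≡ ι (∑ xs h)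
∑-ι []       e = refl
∑-ι (x ∷ xs) {h = h} e =
  trans (cong₂ ℚ._+_ (e (here refl)) (∑-ι xs (e ∘ there))) (sym (ι-+ (h x) _))

f-ι : (z x : Subset n) → f z x ≡ ι [ z ⊑ x ]
f-ι z x with does (z ⊆? x)
... | true  = refl
... | false = refl

-- The second hypothesis says s / l = ρ / d: `s / l` is an average over a shell, `N` the total
-- weight there, and the factor `d` clears the fraction.
ι-ratio : ∀ N {d s l ρ} → 0 < l → d * s ≡ ρ * l →
          ι d ℚ.* ((ι N ℚ.* (1/′ l)) ℚ.* ι s) ≡ ι (N * ρ)
ι-ratio N {d} {s} {l} {ρ} 0<l e = begin
  ι d ℚ.* ((ι N ℚ.* (1/′ l)) ℚ.* ι s)
    ≡⟨ solve 4 (λ d N q s → d :* ((N :* q) :* s) := (N :* q) :* (d :* s)) refl (ι d) (ι N) (1/′ l) (ι s) ⟩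
  (ι N ℚ.* (1/′ l)) ℚ.* (ι d ℚ.* ι s)
    ≡⟨ cong ((ι N ℚ.* (1/′ l)) ℚ.*_) (trans (sym (ι-* d s)) (trans (cong ι e) (ι-* ρ l))) ⟩
  (ι N ℚ.* (1/′ l)) ℚ.* (ι ρ ℚ.* ι l)
    ≡⟨ solve 4 (λ N q r l → (N :* q) :* (r :* l) := (N :* r) :* (l :* q)) refl (ι N) (1/′ l) (ι ρ) (ι l) ⟩
  (ι N ℚ.* ι ρ) ℚ.* (ι l ℚ.* (1/′ l)) ≡⟨ cong ((ι N ℚ.* ι ρ) ℚ.*_) (ι-inverse 0<l) ⟩
  (ι N ℚ.* ι ρ) ℚ.* 1ℚ                ≡⟨ ℚ.*-identityʳ (ι N ℚ.* ι ρ) ⟩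
  ι N ℚ.* ι ρ                         ≡⟨ sym (ι-* N ρ) ⟩
  ι (N * ρ) ∎
  where open +-*-Solver

-- Moments of intersection sizes

choose₂ : ∀ m → 2 * (m C 2) + m ≡ m * m
choose₂ zero    = refl
choose₂ (suc m) = begin
  2 * (suc m C 2) + suc m       ≡⟨ cong (λ t → 2 * t + suc m) (sym (nCk+nC[k+1]≡[n+1]C[k+1] m 1)) ⟩
  2 * (m C 1 + m C 2) + suc m   ≡⟨ cong (λ t → 2 * (t + m C 2) + suc m) (nC1≡n m) ⟩
  2 * (m + m C 2) + suc m       ≡⟨ collect m (m C 2) ⟩
  (2 * (m C 2) + m) + 2 * m + 1 ≡⟨ cong (λ t → t + 2 * m + 1) (choose₂ m) ⟩
  m * m + 2 * m + 1             ≡⟨ square m ⟩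
  suc m * suc m                 ∎
  where
  collect : ∀ m c → 2 * (m + c) + suc m ≡ (2 * c + m) + 2 * m + 1
  collect = solve-∀
  square : ∀ m → m * m + 2 * m + 1 ≡ suc m * suc m
  square = solve-∀

-- Expands m (m - 1) (m - 2), with the negative term carried to the left; this converts binomial
-- moments into power moments.
choose₃ : ∀ m → 6 * (m C 3) + 3 * (m * m) ≡ m * m * m + 2 * m
choose₃ zero    = refl
choose₃ (suc m) = begin
  6 * (suc m C 3) + 3 * (suc m * suc m)
    ≡⟨ cong (λ t → 6 * t + 3 * (suc m * suc m)) (sym (nCk+nC[k+1]≡[n+1]C[k+1] m 2)) ⟩
  6 * (m C 2 + m C 3) + 3 * (suc m * suc m)
    ≡⟨ collect m (m C 2) (m C 3) ⟩
  (6 * (m C 3) + 3 * (m * m)) + 3 * (2 * (m C 2) + m) + 3 * m + 3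
    ≡⟨ cong₂ (λ s t → s + 3 * t + 3 * m + 3) (choose₃ m) (choose₂ m) ⟩
  (m * m * m + 2 * m) + 3 * (m * m) + 3 * m + 3
    ≡⟨ cube m ⟩
  suc m * suc m * suc m + 2 * suc m ∎
  where
  collect : ∀ m c d → 6 * (c + d) + 3 * (suc m * suc m) ≡
                      (6 * d + 3 * (m * m)) + 3 * (2 * c + m) + 3 * m + 3
  collect = solve-∀
  cube : ∀ m → (m * m * m + 2 * m) + 3 * (m * m) + 3 * m + 3 ≡ suc m * suc m * suc m + 2 * suc m
  cube = solve-∀

∣-∣-square : ∀ m k → ∣ m - k ∣ * ∣ m - k ∣ + 2 * k * m ≡ m * m + k * k
∣-∣-square zero    k       = trans (cong (k * k +_) (*-zeroʳ (2 * k))) (+-identityʳ (k * k))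
∣-∣-square (suc m) zero    = refl
∣-∣-square (suc m) (suc k) = begin
  ∣ m - k ∣ * ∣ m - k ∣ + 2 * suc k * suc m
    ≡⟨ expand (∣ m - k ∣ * ∣ m - k ∣) m k ⟩
  (∣ m - k ∣ * ∣ m - k ∣ + 2 * k * m) + 2 * k + 2 * m + 2
    ≡⟨ cong (λ t → t + 2 * k + 2 * m + 2) (∣-∣-square m k) ⟩
  (m * m + k * k) + 2 * k + 2 * m + 2
    ≡⟨ collect m k ⟩
  suc m * suc m + suc k * suc k ∎
  where
  expand : ∀ d m k → d + 2 * suc k * suc m ≡ (d + 2 * k * m) + 2 * k + 2 * m + 2
  expand = solve-∀
  collect : ∀ m k → (m * m + k * k) + 2 * k + 2 * m + 2 ≡ suc m * suc m + suc k * suc k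
  collect = solve-∀

-- M₁, M₂, M₃ are the sums of m, m², m³, and Q is that of (m − u)² m.  Both hypotheses
-- are kept free of subtraction.
solve-moments : ∀ v Q M₃ →
  let s  = 2 * v + 2
      M₁ = s * (4 * v + 3)
      M₂ = s * (2 * v + 1) * (2 * v + 1) + M₁
  in Q + 2 * suc v * M₂ ≡ M₃ + suc v * suc v * M₁ →
     M₃ + 2 * M₁ ≡ s * (2 * v + 1) * (2 * v) * v + 3 * M₂ →
     Q ≡ suc v * suc v * s
solve-moments v Q M₃ e₁ e₂ = +-cancelʳ-≡ X Q (suc v * suc v * (2 * v + 2)) (begin
  Q + X              ≡⟨ sym (+-assoc Q X₁ X₂) ⟩
  Q + X₁ + X₂        ≡⟨ cong (_+ X₂) e₁ ⟩
  M₃ + X₃ + X₂       ≡⟨ swap M₃ X₃ X₂ ⟩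
  M₃ + X₂ + X₃       ≡⟨ cong (_+ X₃) e₂ ⟩
  -- `M₃` is eliminated and `M₁`, `M₂` are explicit, so a polynomial identity in `v` remains.
  _                  ≡⟨ skewness v ⟩
  suc v * suc v * (2 * v + 2) + X ∎)
  where
  s = 2 * v + 2
  M₁ = s * (4 * v + 3)
  M₂ = s * (2 * v + 1) * (2 * v + 1) + M₁
  X₁ = 2 * suc v * M₂
  X₂ = 2 * M₁
  X₃ = suc v * suc v * M₁
  X = X₁ + X₂
  swap : ∀ a b c → a + b + c ≡ a + c + b
  swap = solve-∀
  skewness : ∀ v →
    let s  = 2 * v + 2
        M₁ = s * (4 * v + 3)
        M₂ = s * (2 * v + 1) * (2 * v + 1) + M₁
    in s * (2 * v + 1) * (2 * v) * v + 3 * M₂ + suc v * suc v * M₁ ≡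
       suc v * suc v * s + (2 * suc v * M₂ + 2 * M₁)
  skewness = solve-∀

-- `x` is a test set of size 2u: either a member of `Ys`, or the complement of one whose own
-- membership is still to be proved.
module CentralMoments {n v : ℕ} (Ys : List (Subset n)) (x : Subset n)
  (length≡ : length Ys ≡ 2 * (4 * v + 3)) (∣x∣≡ : ∣ x ∣ ≡ 2 * v + 2)
  (degree₁ : ∀ z → ∣ z ∣ ≡ 1 → degree Ys z ≡ 4 * v + 3)
  (degree₂ : ∀ z → ∣ z ∣ ≡ 2 → degree Ys z ≡ 2 * v + 1)
  (degree₃ : ∀ z → ∣ z ∣ ≡ 3 → degree Ys z ≡ v)
  where

  m p : Subset n → ℕ
  m y = ∣ x ∩ y ∣
  p y = ∣ m y - suc v ∣ * ∣ m y - suc v ∣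

  private
    s = 2 * v + 2

    C₂ : 2 * (s C 2) ≡ s * (2 * v + 1)
    C₂ = +-cancelʳ-≡ s _ _ (trans (choose₂ s) (square v))
      where
      square : ∀ v → (2 * v + 2) * (2 * v + 2) ≡ (2 * v + 2) * (2 * v + 1) + (2 * v + 2)
      square = solve-∀

    C₃ : 6 * (s C 3) ≡ s * (2 * v + 1) * (2 * v)
    C₃ = +-cancelʳ-≡ (3 * (s * s)) _ _ (trans (choose₃ s) (cube v))
      where
      cube : ∀ v → (2 * v + 2) * (2 * v + 2) * (2 * v + 2) + 2 * (2 * v + 2) ≡
                   (2 * v + 2) * (2 * v + 1) * (2 * v) + 3 * ((2 * v + 2) * (2 * v + 2))
      cube = solve-∀

    M₁ M₂ : ℕ
    M₁ = s * (4 * v + 3)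
    M₂ = s * (2 * v + 1) * (2 * v + 1) + M₁

    ∑m : ∑ Ys m ≡ M₁
    ∑m = trans (∑-∣∩∣ Ys x degree₁) (cong (_* (4 * v + 3)) ∣x∣≡)

    ∑m² : ∑ Ys (λ y → m y * m y) ≡ M₂
    ∑m² = begin
      ∑ Ys (λ y → m y * m y)
        ≡⟨ ∑-cong Ys (λ y → sym (choose₂ (m y))) ⟩
      ∑ Ys (λ y → 2 * (m y C 2) + m y)
        ≡⟨ ∑-+ Ys (λ y → 2 * (m y C 2)) m ⟩
      ∑ Ys (λ y → 2 * (m y C 2)) + ∑ Ys m
        ≡⟨ cong₂ _+_ (trans (∑-*ˡ Ys 2 (λ y → m y C 2)) (cong (2 *_) (∑-moment Ys x 2 degree₂))) ∑m ⟩
      2 * ((∣ x ∣ C 2) * (2 * v + 1)) + M₁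
        ≡⟨ cong (_+ M₁) (trans (cong (λ t → 2 * ((t C 2) * (2 * v + 1))) ∣x∣≡)
             (trans (sym (*-assoc 2 (s C 2) (2 * v + 1))) (cong (_* (2 * v + 1)) C₂))) ⟩
      M₂ ∎

    ∑m³ : ∑ Ys (λ y → m y * m y * m y) + 2 * M₁ ≡ s * (2 * v + 1) * (2 * v) * v + 3 * M₂
    ∑m³ = begin
      ∑ Ys (λ y → m y * m y * m y) + 2 * M₁
        ≡⟨ cong (∑ Ys (λ y → m y * m y * m y) +_) (trans (cong (2 *_) (sym ∑m)) (sym (∑-*ˡ Ys 2 m))) ⟩
      ∑ Ys (λ y → m y * m y * m y) + ∑ Ys (λ y → 2 * m y)
        ≡⟨ sym (∑-+ Ys (λ y → m y * m y * m y) (λ y → 2 * m y)) ⟩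
      ∑ Ys (λ y → m y * m y * m y + 2 * m y)
        ≡⟨ ∑-cong Ys (λ y → sym (choose₃ (m y))) ⟩
      ∑ Ys (λ y → 6 * (m y C 3) + 3 * (m y * m y))
        ≡⟨ ∑-+ Ys (λ y → 6 * (m y C 3)) (λ y → 3 * (m y * m y)) ⟩
      ∑ Ys (λ y → 6 * (m y C 3)) + ∑ Ys (λ y → 3 * (m y * m y))
        ≡⟨ cong₂ _+_ (trans (∑-*ˡ Ys 6 (λ y → m y C 3)) (cong (6 *_) (∑-moment Ys x 3 degree₃)))
                     (trans (∑-*ˡ Ys 3 (λ y → m y * m y)) (cong (3 *_) ∑m²)) ⟩
      6 * ((∣ x ∣ C 3) * v) + 3 * M₂
        ≡⟨ cong (_+ 3 * M₂) (trans (cong (λ t → 6 * ((t C 3) * v)) ∣x∣≡)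
             (trans (sym (*-assoc 6 (s C 3) v)) (cong (_* v) C₃))) ⟩
      s * (2 * v + 1) * (2 * v) * v + 3 * M₂ ∎

  ∑p : ∑ Ys p ≡ 2 * (suc v * suc v)
  ∑p = +-cancelʳ-≡ (2 * suc v * M₁) _ _ (begin
    ∑ Ys p + 2 * suc v * M₁
      ≡⟨ cong (∑ Ys p +_) (trans (cong (2 * suc v *_) (sym ∑m)) (sym (∑-*ˡ Ys (2 * suc v) m))) ⟩
    ∑ Ys p + ∑ Ys (λ y → 2 * suc v * m y)
      ≡⟨ sym (∑-+ Ys p (λ y → 2 * suc v * m y)) ⟩
    ∑ Ys (λ y → p y + 2 * suc v * m y)
      ≡⟨ ∑-cong Ys (λ y → ∣-∣-square (m y) (suc v)) ⟩
    ∑ Ys (λ y → m y * m y + suc v * suc v)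
      ≡⟨ ∑-+ Ys (λ y → m y * m y) (λ _ → suc v * suc v) ⟩
    ∑ Ys (λ y → m y * m y) + ∑ Ys (λ _ → suc v * suc v)
      ≡⟨ cong₂ _+_ ∑m² (trans (∑-const Ys (suc v * suc v)) (cong (_* (suc v * suc v)) length≡)) ⟩
    M₂ + 2 * (4 * v + 3) * (suc v * suc v)
      ≡⟨ variance v ⟩
    2 * (suc v * suc v) + 2 * suc v * M₁ ∎)
    where
    variance : ∀ v →
      (2 * v + 2) * (2 * v + 1) * (2 * v + 1) + (2 * v + 2) * (4 * v + 3) + 2 * (4 * v + 3) * (suc v * suc v) ≡
      2 * (suc v * suc v) + 2 * suc v * ((2 * v + 2) * (4 * v + 3))
    variance = solve-∀

  ∑pm : ∑ Ys (λ y → p y * m y) ≡ suc v * suc v * s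
  ∑pm = solve-moments v Q M₃ identity ∑m³
    where
    Q M₃ : ℕ
    Q  = ∑ Ys (λ y → p y * m y)
    M₃ = ∑ Ys (λ y → m y * m y * m y)
    factor : ∀ d u m → d * m + 2 * u * (m * m) ≡ (d + 2 * u * m) * m
    factor = solve-∀
    unfactor : ∀ u m → (m * m + u * u) * m ≡ m * m * m + u * u * m
    unfactor = solve-∀
    pointwise : ∀ y → p y * m y + 2 * suc v * (m y * m y) ≡ m y * m y * m y + suc v * suc v * m y
    pointwise y = trans (factor (p y) (suc v) (m y))
      (trans (cong (_* m y) (∣-∣-square (m y) (suc v))) (unfactor (suc v) (m y)))
    identity : Q + 2 * suc v * M₂ ≡ M₃ + suc v * suc v * M₁
    identity = begin
      Q + 2 * suc v * M₂
        ≡⟨ cong (Q +_)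
             (trans (cong (2 * suc v *_) (sym ∑m²)) (sym (∑-*ˡ Ys (2 * suc v) (λ y → m y * m y)))) ⟩
      Q + ∑ Ys (λ y → 2 * suc v * (m y * m y))
        ≡⟨ sym (∑-+ Ys (λ y → p y * m y) (λ y → 2 * suc v * (m y * m y))) ⟩
      ∑ Ys (λ y → p y * m y + 2 * suc v * (m y * m y))
        ≡⟨ ∑-cong Ys pointwise ⟩
      ∑ Ys (λ y → m y * m y * m y + suc v * suc v * m y)
        ≡⟨ ∑-+ Ys (λ y → m y * m y * m y) (λ y → suc v * suc v * m y) ⟩
      M₃ + ∑ Ys (λ y → suc v * suc v * m y)
        ≡⟨ cong (M₃ +_) (trans (∑-*ˡ Ys (suc v * suc v) m) (cong (suc v * suc v *_) ∑m)) ⟩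
      M₃ + suc v * suc v * M₁ ∎

  private
    -- u² is the value of `p` at m = 0 and at m = 2u; one such member leaves an equal amount for the
    -- others.
    u²<∑p : suc v * suc v < ∑ Ys p
    u²<∑p = subst (suc v * suc v <_) (sym (trans ∑p (cong (suc v * suc v +_) (+-identityʳ _))))
              (m<m+n (suc v * suc v) (s≤s z≤n))

  ∃-disjoint : x ∈ Ys → ∃[ y ] y ∈ Ys × m y ≡ 0
  ∃-disjoint x∈ = ∃-zero p m x∈ (subst (_< ∑ Ys p) (sym px) u²<∑p)
      (≤-reflexive (trans ∑pm (cong₂ _*_ (sym px) (sym mx))))
    where
    mx : m x ≡ s
    mx = trans (cong ∣_∣ (∩-idem x)) ∣x∣≡
    s-u : ∀ v → 2 * v + 2 ≡ suc v + suc v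
    s-u = solve-∀
    px : p x ≡ suc v * suc v
    px = cong (λ t → t * t) (trans (cong (∣_- suc v ∣) (trans mx (s-u v)))
           (trans (∣-∣-comm (suc v + suc v) (suc v)) (∣m-m+n∣≡n (suc v) (suc v))))

  ∃-containing : ∀ {y₀} → y₀ ∈ Ys → m y₀ ≡ 0 → ∃[ y ] y ∈ Ys × m y ≡ ∣ x ∣
  ∃-containing {y₀} y₀∈ my₀ = full (∃-zero p (λ y → s ∸ m y) y₀∈ (subst (_< ∑ Ys p) (sym py₀) u²<∑p)
      (≤-reflexive (trans ∑pq (cong₂ _*_ (sym py₀) (cong (s ∸_) (sym my₀))))))
    where
    full : ∃[ y ] y ∈ Ys × s ∸ m y ≡ 0 → ∃[ y ] y ∈ Ys × m y ≡ ∣ x ∣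
    full (y , y∈ , e) = y , y∈ , ≤-antisym (∣p∩q∣≤∣p∣ x y) (subst (_≤ m y) (sym ∣x∣≡) (m∸n≡0⇒m≤n e))
    py₀ : p y₀ ≡ suc v * suc v
    py₀ = cong (λ t → ∣ t - suc v ∣ * ∣ t - suc v ∣) my₀
    m≤s : ∀ y → m y ≤ s
    m≤s y = subst (m y ≤_) ∣x∣≡ (∣p∩q∣≤∣p∣ x y)
    double : ∀ v → 2 * (suc v * suc v) * (2 * v + 2) ≡
                   suc v * suc v * (2 * v + 2) + suc v * suc v * (2 * v + 2)
    double = solve-∀
    -- Taking the sum u² s of p m from s times the sum 2u² of p leaves u² s again, which is exactly
    -- the term of the disjoint member `y₀`.
    ∑pq : ∑ Ys (λ y → p y * (s ∸ m y)) ≡ suc v * suc v * s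
    ∑pq = +-cancelʳ-≡ (suc v * suc v * s) (∑ Ys (λ y → p y * (s ∸ m y))) (suc v * suc v * s) (begin
      ∑ Ys (λ y → p y * (s ∸ m y)) + suc v * suc v * s
        ≡⟨ cong (∑ Ys (λ y → p y * (s ∸ m y)) +_) (sym ∑pm) ⟩
      ∑ Ys (λ y → p y * (s ∸ m y)) + ∑ Ys (λ y → p y * m y)
        ≡⟨ sym (∑-+ Ys (λ y → p y * (s ∸ m y)) (λ y → p y * m y)) ⟩
      ∑ Ys (λ y → p y * (s ∸ m y) + p y * m y)
        ≡⟨ ∑-cong Ys (λ y → trans (sym (*-distribˡ-+ (p y) (s ∸ m y) (m y)))
                                  (cong (p y *_) (m∸n+n≡m (m≤s y)))) ⟩
      ∑ Ys (λ y → p y * s)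
        ≡⟨ trans (∑-*ʳ Ys s p) (cong (_* s) ∑p) ⟩
      2 * (suc v * suc v) * s
        ≡⟨ double v ⟩
      suc v * suc v * s + suc v * suc v * s ∎)

-- Complements and sets of size at most three

⊆-∣∣≡⇒≡ : {p q : Subset n} → p ⊆ q → ∣ p ∣ ≡ ∣ q ∣ → p ≡ q
⊆-∣∣≡⇒≡ {p = []}          {[]}          _   _ = refl
⊆-∣∣≡⇒≡ {p = outside ∷ p} {outside ∷ q} p⊆q e = cong (outside ∷_) (⊆-∣∣≡⇒≡ (drop-∷-⊆ p⊆q) e)
⊆-∣∣≡⇒≡ {p = outside ∷ p} {inside ∷ q}  p⊆q e =
  contradiction e (<⇒≢ (s≤s (p⊆q⇒∣p∣≤∣q∣ (drop-∷-⊆ p⊆q))))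
⊆-∣∣≡⇒≡ {p = inside ∷ p}  {outside ∷ q} p⊆q e = contradiction (p⊆q here) λ ()
⊆-∣∣≡⇒≡ {p = inside ∷ p}  {inside ∷ q}  p⊆q e =
  cong (inside ∷_) (⊆-∣∣≡⇒≡ (drop-∷-⊆ p⊆q) (suc-injective e))

∁-involutive : (p : Subset n) → ∁ (∁ p) ≡ p
∁-involutive []            = refl
∁-involutive (outside ∷ p) = cong (outside ∷_) (∁-involutive p)
∁-involutive (inside ∷ p)  = cong (inside ∷_) (∁-involutive p)

∁-injective : {p q : Subset n} → ∁ p ≡ ∁ q → p ≡ q
∁-injective {p = p} {q} e = trans (sym (∁-involutive p)) (trans (cong ∁ e) (∁-involutive q))

⊑-sound : (z x : Subset n) → [ z ⊑ x ] ≡ 1 → z ⊆ x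
⊑-sound z x e = decidable-stable (z ⊆? x)
  (λ z⊈x → 1+n≢0 (trans (sym e) (cong ⟦_⟧ (dec-false (z ⊆? x) z⊈x))))

pair-∣∣ : {i j : Fin n} → i ≢ j → ∣ ⁅ i ⁆ ∪ ⁅ j ⁆ ∣ ≡ 2
pair-∣∣ {i = zero}  {zero}  i≢j = contradiction refl i≢j
pair-∣∣ {i = zero}  {suc j} i≢j = cong suc (trans (cong ∣_∣ (∪-identityˡ ⁅ j ⁆)) (∣⁅x⁆∣≡1 j))
pair-∣∣ {i = suc i} {zero}  i≢j = cong suc (trans (cong ∣_∣ (∪-identityʳ ⁅ i ⁆)) (∣⁅x⁆∣≡1 i))
pair-∣∣ {i = suc i} {suc j} i≢j = pair-∣∣ (i≢j ∘ cong suc)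

∣∣≡0⇒⊥ : (z : Subset n) → ∣ z ∣ ≡ 0 → z ≡ ⊥
∣∣≡0⇒⊥ {n} z e = sym (⊆-∣∣≡⇒≡ ⊥⊆ (trans (∣⊥∣≡0 n) (sym e)))

∣∣≡1⇒singleton : (z : Subset n) → ∣ z ∣ ≡ 1 → ∃[ i ] z ≡ ⁅ i ⁆
∣∣≡1⇒singleton (outside ∷ z) e with ∣∣≡1⇒singleton z e
... | i , refl = suc i , refl
∣∣≡1⇒singleton (inside ∷ z)  e = zero , cong (inside ∷_) (∣∣≡0⇒⊥ z (suc-injective e))

∣∣≡2⇒pair : (z : Subset n) → ∣ z ∣ ≡ 2 → ∃[ i ] ∃[ j ] i ≢ j × z ≡ ⁅ i ⁆ ∪ ⁅ j ⁆
∣∣≡2⇒pair (outside ∷ z) e with ∣∣≡2⇒pair z e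
... | i , j , i≢j , refl = suc i , suc j , (λ { refl → i≢j refl }) , refl
∣∣≡2⇒pair (inside ∷ z)  e with ∣∣≡1⇒singleton z (suc-injective e)
... | j , refl = zero , suc j , (λ ()) , cong (inside ∷_) (sym (∪-identityˡ ⁅ j ⁆))

length-blocksThrough : (i j : Fin n) (ℬ : List (Subset n)) →
                       length (blocksThrough i j ℬ) ≡ degree ℬ (⁅ i ⁆ ∪ ⁅ j ⁆)
length-blocksThrough {n} i j ℬ = begin
  length (blocksThrough i j ℬ)                         ≡⟨ sym (∑-one (blocksThrough i j ℬ)) ⟩
  ∑ (blocksThrough i j ℬ) (λ _ → 1)                    ≡⟨ ∑-filter (λ B → (i ∈? B) ×-dec (j ∈? B)) ℬ (λ _ → 1) ⟩
  ∑ ℬ (λ B → ⟦ does ((i ∈? B) ×-dec (j ∈? B)) ⟧ * 1) ≡⟨ ∑-cong ℬ indicator ⟩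
  degree ℬ (⁅ i ⁆ ∪ ⁅ j ⁆) ∎
  where
  to : ∀ {B} → i ∈ˢ B × j ∈ˢ B → ⁅ i ⁆ ∪ ⁅ j ⁆ ⊆ B
  to {B} (i∈B , j∈B) x∈ with x∈p∪q⁻ ⁅ i ⁆ ⁅ j ⁆ x∈
  ... | inj₁ x∈i = subst (_∈ˢ B) (sym (x∈⁅y⁆⇒x≡y i x∈i)) i∈B
  ... | inj₂ x∈j = subst (_∈ˢ B) (sym (x∈⁅y⁆⇒x≡y j x∈j)) j∈B
  from : ∀ {B} → ⁅ i ⁆ ∪ ⁅ j ⁆ ⊆ B → i ∈ˢ B × j ∈ˢ B
  from ij⊆B = ij⊆B (x∈p∪q⁺ (inj₁ (x∈⁅x⁆ i))) , ij⊆B (x∈p∪q⁺ (inj₂ (x∈⁅x⁆ j)))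
  indicator : ∀ B → ⟦ does ((i ∈? B) ×-dec (j ∈? B)) ⟧ * 1 ≡ [ ⁅ i ⁆ ∪ ⁅ j ⁆ ⊑ B ]
  indicator B = trans (*-identityʳ _)
    (cong ⟦_⟧ (does-⇔ (mk⇔ to from) ((i ∈? B) ×-dec (j ∈? B)) (⁅ i ⁆ ∪ ⁅ j ⁆ ⊆? B)))

unique-⊆⇒↭-++ : {xs ys : List A} → Unique xs → (∀ {x} → x ∈ xs → x ∈ ys) →
                ∃[ zs ] ys ↭ xs ++ zs
unique-⊆⇒↭-++ {xs = []}     {ys} _ _ = ys , ↭-refl
unique-⊆⇒↭-++ {xs = x ∷ xs} {ys} (x∉xs ∷ uxs) xs⊆ys with unique-⊆⇒↭-++ uxs (xs⊆ys ∘ there)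
... | zs , ys↭ with ∈-++⁻ xs (↭.∈-resp-↭ ys↭ (xs⊆ys (here refl)))
...   | inj₁ x∈xs = contradiction refl (All.lookup x∉xs x∈xs)
...   | inj₂ x∈zs with ∈-∃++ x∈zs
...     | as , bs , refl = as ++ bs , ↭-trans ys↭ (↭-trans (↭.++⁺ˡ xs (↭.shift x as bs)) (↭.shift x xs (as ++ bs)))

-- Pigeonhole: `ys` is `xs` with a remainder, which equal lengths force to be empty.
unique-⊆-length⇒↭ : {xs ys : List A} → Unique xs → (∀ {x} → x ∈ xs → x ∈ ys) →
                    length xs ≡ length ys → ys ↭ xs
unique-⊆-length⇒↭ {xs = xs} {ys} uxs xs⊆ys e with unique-⊆⇒↭-++ uxs xs⊆ys
... | []     , ys↭ = subst (ys ↭_) (++-identityʳ xs) ys↭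
... | z ∷ zs , ys↭ = contradiction (trans e (trans (↭.↭-length ys↭) (length-++ xs)))
                       (<⇒≢ (m<m+n (length xs) (s≤s z≤n)))

∈-allPoints : (x : Subset n) → x ∈ allPoints n
∈-allPoints []            = here refl
∈-allPoints (outside ∷ x) = ∈-++⁺ˡ (∈-map⁺ (outside ∷_) (∈-allPoints x))
∈-allPoints (inside ∷ x)  = ∈-++⁺ʳ _ (∈-map⁺ (inside ∷_) (∈-allPoints x))

-- Inclusion–exclusion, with the sum over the points (resp. pairs) of z that lie in
-- y written as ∣ z ∩ y ∣ (resp. ∣ z ∩ y ∣ C 2).
⊑-pair : (z y : Subset n) → ∣ z ∣ ≡ 2 → [ z ⊑ y ] + [ z ⊑ ∁ y ] + ∣ z ∩ y ∣ ≡ 1 + 2 * [ z ⊑ y ]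
⊑-pair z y e rewrite ⊑-∣∩∣ z y | ⊑-∁-∣∩∣ z y | e = small ∣ z ∩ y ∣ (subst (∣ z ∩ y ∣ ≤_) e (∣p∩q∣≤∣p∣ z y))
  where
  small : ∀ m → m ≤ 2 → [ m ≐ 2 ] + [ m ≐ 0 ] + m ≡ 1 + 2 * [ m ≐ 2 ]
  small 0 _ = refl
  small 1 _ = refl
  small 2 _ = refl
  small (suc (suc (suc _))) (s≤s (s≤s ()))

⊑-triple : (z y : Subset n) → ∣ z ∣ ≡ 3 → [ z ⊑ y ] + [ z ⊑ ∁ y ] + ∣ z ∩ y ∣ ≡ 1 + ∣ z ∩ y ∣ C 2
⊑-triple z y e rewrite ⊑-∣∩∣ z y | ⊑-∁-∣∩∣ z y | e = small ∣ z ∩ y ∣ (subst (∣ z ∩ y ∣ ≤_) e (∣p∩q∣≤∣p∣ z y))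
  where
  small : ∀ m → m ≤ 3 → [ m ≐ 3 ] + [ m ≐ 0 ] + m ≡ 1 + m C 2
  small 0 _ = refl
  small 1 _ = refl
  small 2 _ = refl
  small 3 _ = refl
  small (suc (suc (suc (suc _)))) (s≤s (s≤s (s≤s ())))

⊑-single : (z y : Subset n) → ∣ z ∣ ≡ 1 → [ z ⊑ y ] + [ z ⊑ ∁ y ] ≡ 1
⊑-single z y e rewrite ⊑-∣∩∣ z y | ⊑-∁-∣∩∣ z y | e = small ∣ z ∩ y ∣ (subst (∣ z ∩ y ∣ ≤_) e (∣p∩q∣≤∣p∣ z y))
  where
  small : ∀ m → m ≤ 1 → [ m ≐ 1 ] + [ m ≐ 0 ] ≡ 1
  small 0 _ = refl
  small 1 _ = refl
  small (suc (suc _)) (s≤s ())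

-- Relative designs of weight 1

-- Multiplies s₁ / s₀ = c / n by s₂ / s₁ = b / a; since b c is `ρ` times a, the denominator stays n.
chain-ratio : ∀ {s₀ s₁ s₂ a b c ρ} n → 0 < a → n * s₁ ≡ c * s₀ → a * s₂ ≡ b * s₁ → b * c ≡ a * ρ →
              n * s₂ ≡ ρ * s₀
chain-ratio {s₀} {s₁} {s₂} {a} {b} {c} {ρ} n 0<a e₁ e₂ e =
  *-cancelˡ-≡ (n * s₂) (ρ * s₀) a {{>-nonZero 0<a}} (begin
    a * (n * s₂) ≡⟨ exchange a n s₂ ⟩
    n * (a * s₂) ≡⟨ cong (n *_) e₂ ⟩
    n * (b * s₁) ≡⟨ exchange n b s₁ ⟩
    b * (n * s₁) ≡⟨ cong (b *_) e₁ ⟩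
    b * (c * s₀) ≡⟨ sym (*-assoc b c s₀) ⟩
    b * c * s₀   ≡⟨ cong (_* s₀) e ⟩
    a * ρ * s₀   ≡⟨ *-assoc a ρ s₀ ⟩
    a * (ρ * s₀) ∎)
  where
  exchange : ∀ a b c → a * (b * c) ≡ b * (a * c)
  exchange = solve-∀

-- Averages over a shell for sets of one, two and three points

module _ (v : ℕ) where
  private
    N = 4 * v + 3

  shellRatio₁ : ∀ r → N * shellDegree N r 1 ≡ r * shellDegree N r 0
  shellRatio₁ r = trans (cong (_* shellDegree N r 1) (N≡ v)) (shellDegree-suc {N} r 0 (N≡ v))
    where
    N≡ : ∀ v → 4 * v + 3 ≡ suc (4 * v + 2)
    N≡ = solve-∀

  -- The average is r (r - 1) / (N (N - 1)). For both shells r (r - 1) is a multiple of N - 1 = 4v +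
  -- 2, so the denominator N suffices.
  shellRatio₂ : ∀ r b ρ → r ∸ 1 ≡ b → b * r ≡ (4 * v + 2) * ρ →
                N * shellDegree N r 2 ≡ ρ * shellDegree N r 0
  shellRatio₂ r b ρ e h = chain-ratio {b = b} {c = r} N (≤-trans (s≤s z≤n) (m≤n+m 2 (4 * v))) (shellRatio₁ r)
    (trans (cong (_* shellDegree N r 2) (M≡ v))
      (trans (shellDegree-suc {N} r 1 (cong (_∸ 1) (N≡ v))) (cong (_* shellDegree N r 1) e))) h
    where
    N≡ : ∀ v → 4 * v + 3 ≡ suc (suc (4 * v + 1))
    N≡ = solve-∀
    M≡ : ∀ v → 4 * v + 2 ≡ suc (4 * v + 1)
    M≡ = solve-∀

  -- The next factor (r - 2) / (4v + 1) is left uncancelled, whence the denominator (4v + 1) N.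
  shellRatio₃ : ∀ r t ρ → r ∸ 2 ≡ t → N * shellDegree N r 2 ≡ ρ * shellDegree N r 0 →
                ((4 * v + 1) * N) * shellDegree N r 3 ≡ (t * ρ) * shellDegree N r 0
  shellRatio₃ r t ρ e h = begin
    ((4 * v + 1) * N) * s₃ ≡⟨ exchange (4 * v + 1) N s₃ ⟩
    N * ((4 * v + 1) * s₃) ≡⟨ cong (N *_) ratio ⟩
    N * (t * s₂)           ≡⟨ exchange′ N t s₂ ⟩
    t * (N * s₂)           ≡⟨ cong (t *_) h ⟩
    t * (ρ * s₀)           ≡⟨ sym (*-assoc t ρ s₀) ⟩
    (t * ρ) * s₀           ∎
    where
    s₀ = shellDegree N r 0
    s₂ = shellDegree N r 2
    s₃ = shellDegree N r 3
    N≡ : ∀ v → 4 * v + 3 ≡ suc (suc (suc (4 * v)))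
    N≡ = solve-∀
    M≡ : ∀ v → 4 * v + 1 ≡ suc (4 * v)
    M≡ = solve-∀
    ratio : (4 * v + 1) * s₃ ≡ t * s₂
    ratio = trans (cong (_* s₃) (M≡ v))
      (trans (shellDegree-suc {N} r 2 (cong (_∸ 2) (N≡ v))) (cong (_* s₂) e))
    exchange : ∀ a b c → (a * b) * c ≡ b * (a * c)
    exchange = solve-∀
    exchange′ : ∀ a b c → a * (b * c) ≡ b * (a * c)
    exchange′ = solve-∀

module UnitWeights {n r₁ r₂ : ℕ} (𝒴 : WeightedSubset n r₁ r₂)
  (w≡1 : ∀ {y} → y ∈ WeightedSubset.Y 𝒴 → WeightedSubset.w 𝒴 y ≡ 1ℚ) where
  open WeightedSubset 𝒴

  ∈-Y[] : ∀ {r y} → y ∈ Y[_] 𝒴 r → y ∈ Y × ∣ y ∣ ≡ r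
  ∈-Y[] {r} = ∈-filter⁻ (λ y → ∣ y ∣ ≟ r)

  Y[]-∈ : ∀ {r y} → y ∈ Y → ∣ y ∣ ≡ r → y ∈ Y[_] 𝒴 r
  Y[]-∈ {r} = ∈-filter⁺ (λ y → ∣ y ∣ ≟ r)

  unique[] : ∀ r → Unique (Y[_] 𝒴 r)
  unique[] r = Unique.filter⁺ (λ y → ∣ y ∣ ≟ r) unique

  ∑-shells : r₁ ≢ r₂ → (g : Subset n → ℕ) → ∑ Y g ≡ ∑ (Y[_] 𝒴 r₁) g + ∑ (Y[_] 𝒴 r₂) g
  ∑-shells r₁≢r₂ g = begin
    ∑ Y g
      ≡⟨ ∑-cong-∈ Y on-Y ⟩
    ∑ Y (λ y → [ ∣ y ∣ ≐ r₁ ] * g y + [ ∣ y ∣ ≐ r₂ ] * g y)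
      ≡⟨ ∑-+ Y (λ y → [ ∣ y ∣ ≐ r₁ ] * g y) (λ y → [ ∣ y ∣ ≐ r₂ ] * g y) ⟩
    ∑ Y (λ y → [ ∣ y ∣ ≐ r₁ ] * g y) + ∑ Y (λ y → [ ∣ y ∣ ≐ r₂ ] * g y)
      ≡⟨ sym (cong₂ _+_ (∑-filter (λ y → ∣ y ∣ ≟ r₁) Y g) (∑-filter (λ y → ∣ y ∣ ≟ r₂) Y g)) ⟩
    ∑ (Y[_] 𝒴 r₁) g + ∑ (Y[_] 𝒴 r₂) g ∎
    where
    on-Y : ∀ {y} → y ∈ Y → g y ≡ [ ∣ y ∣ ≐ r₁ ] * g y + [ ∣ y ∣ ≐ r₂ ] * g y
    on-Y {y} y∈ with two-shells y∈
    ... | inj₁ e = sym (trans (cong₂ (λ a b → a * g y + b * g y)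
            (trans (cong [_≐ r₁ ] e) (≐-refl r₁)) (≐-no (r₁≢r₂ ∘ trans (sym e))))
            (trans (+-identityʳ _) (*-identityˡ (g y))))
    ... | inj₂ e = sym (trans (cong₂ (λ a b → a * g y + b * g y)
            (≐-no (r₁≢r₂ ∘ sym ∘ trans (sym e))) (trans (cong [_≐ r₂ ] e) (≐-refl r₂)))
            (*-identityˡ (g y)))

  shellTerm-ι : ∀ r z {d ρ} → r ≤ n →
    d * shellDegree n r ∣ z ∣ ≡ ρ * shellDegree n r 0 →
    ι d ℚ.* shellTerm 𝒴 r z ≡ ι (length (Y[_] 𝒴 r) * ρ)
  shellTerm-ι r z {d} {ρ} r≤n e = begin
    ι d ℚ.* (((∑[ Y[_] 𝒴 r ] w) ℚ.* (1/′ length (shell n r))) ℚ.* (∑[ shell n r ] f z))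
      ≡⟨ cong₂ (λ a b → ι d ℚ.* ((a ℚ.* (1/′ length (shell n r))) ℚ.* b)) weights
           (trans (∑-ι (shell n r) {h = [ z ⊑_]} (λ {x} _ → f-ι z x)) (cong ι (degree-shell n r z))) ⟩
    ι d ℚ.* ((ι (length (Y[_] 𝒴 r)) ℚ.* (1/′ length (shell n r))) ℚ.* ι (shellDegree n r ∣ z ∣))
      ≡⟨ cong (λ l → ι d ℚ.* ((ι (length (Y[_] 𝒴 r)) ℚ.* (1/′ l)) ℚ.* ι (shellDegree n r ∣ z ∣)))
           (length-shell n r) ⟩
    ι d ℚ.* ((ι (length (Y[_] 𝒴 r)) ℚ.* (1/′ shellDegree n r 0)) ℚ.* ι (shellDegree n r ∣ z ∣))
      -- `r≤n` makes the shell nonempty, so `1/′` is a true reciprocal here and not its default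
      -- value.
      ≡⟨ ι-ratio (length (Y[_] 𝒴 r)) (shellDegree>0 r≤n) e ⟩
    ι (length (Y[_] 𝒴 r) * ρ) ∎
    where
    weights : ∑[ Y[_] 𝒴 r ] w ≡ ι (length (Y[_] 𝒴 r))
    weights = trans (∑-ι (Y[_] 𝒴 r) {h = λ _ → 1} (λ y∈ → w≡1 (proj₁ (∈-Y[] y∈))))
                    (cong ι (∑-one (Y[_] 𝒴 r)))

  module _ (z : Subset n) {d ρ₁ ρ₂} (0<d : 0 < d) (r₁≤n : r₁ ≤ n) (r₂≤n : r₂ ≤ n)
    (ratio₁ : d * shellDegree n r₁ ∣ z ∣ ≡ ρ₁ * shellDegree n r₁ 0)
    (ratio₂ : d * shellDegree n r₂ ∣ z ∣ ≡ ρ₂ * shellDegree n r₂ 0) where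
    private
      N₁ N₂ : ℕ
      N₁ = length (Y[_] 𝒴 r₁)
      N₂ = length (Y[_] 𝒴 r₂)

      lhs-ι : ι d ℚ.* (shellTerm 𝒴 r₁ z ℚ.+ shellTerm 𝒴 r₂ z) ≡ ι (N₁ * ρ₁ + N₂ * ρ₂)
      lhs-ι = trans (ℚ.*-distribˡ-+ (ι d) (shellTerm 𝒴 r₁ z) (shellTerm 𝒴 r₂ z))
        (trans (cong₂ ℚ._+_ (shellTerm-ι r₁ z r₁≤n ratio₁) (shellTerm-ι r₂ z r₂≤n ratio₂))
               (sym (ι-+ (N₁ * ρ₁) (N₂ * ρ₂))))

      rhs-ι : ∑[ Y ] (λ y → w y ℚ.* f z y) ≡ ι (degree Y z)
      rhs-ι = ∑-ι Y {h = [ z ⊑_]} (λ {y} y∈ → trans (cong (ℚ._* f z y) (w≡1 y∈))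
                                     (trans (ℚ.*-identityˡ (f z y)) (f-ι z y)))

    balanced⇒degree : shellTerm 𝒴 r₁ z ℚ.+ shellTerm 𝒴 r₂ z ≡ ∑[ Y ] (λ y → w y ℚ.* f z y) →
                      d * degree Y z ≡ N₁ * ρ₁ + N₂ * ρ₂
    balanced⇒degree e = ι-injective (begin
      ι (d * degree Y z)                                         ≡⟨ ι-* d (degree Y z) ⟩
      ι d ℚ.* ι (degree Y z)                                     ≡⟨ cong (ι d ℚ.*_) (sym (trans e rhs-ι)) ⟩
      ι d ℚ.* (shellTerm 𝒴 r₁ z ℚ.+ shellTerm 𝒴 r₂ z)           ≡⟨ lhs-ι ⟩
      ι (N₁ * ρ₁ + N₂ * ρ₂)                                      ∎)

    degree⇒balanced : d * degree Y z ≡ N₁ * ρ₁ + N₂ * ρ₂ →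
                      shellTerm 𝒴 r₁ z ℚ.+ shellTerm 𝒴 r₂ z ≡ ∑[ Y ] (λ y → w y ℚ.* f z y)
    degree⇒balanced e = trans (ι-*-cancelˡ d 0<d (begin
      ι d ℚ.* (shellTerm 𝒴 r₁ z ℚ.+ shellTerm 𝒴 r₂ z)           ≡⟨ lhs-ι ⟩
      ι (N₁ * ρ₁ + N₂ * ρ₂)                                      ≡⟨ cong ι (sym e) ⟩
      ι (d * degree Y z)                                         ≡⟨ ι-* d (degree Y z) ⟩
      ι d ℚ.* ι (degree Y z)                                     ∎)) (sym rhs-ι)

nonempty : {xs : List A} → 0 < length xs → ∃[ x ] x ∈ xs
nonempty {xs = x ∷ xs} _ = x , here refl

-- `b` is a positive multiple of `n` that `0 < a` keeps below 2n. This is where the nonemptiness of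
-- both shells enters.
half-of-double : ∀ {n a b} → n ∣ b → 0 < a → 0 < b → a + b ≡ 2 * n → b ≡ n
half-of-double (divides 0 refl) _ () _
half-of-double {n} (divides 1 refl) _ _ _ = +-identityʳ n
half-of-double {n} {a} (divides (suc (suc q)) refl) 0<a _ e =
  contradiction (sym e) (<⇒≢ (≤-<-trans (≤-trans (m≤m+n (2 * n) (q * n)) (≤-reflexive (regroup n q)))
                                        (m<n+m (suc (suc q) * n) 0<a)))
  where
  regroup : ∀ n q → 2 * n + q * n ≡ suc (suc q) * n
  regroup = solve-∀

-- For v > 0 the replication number follows by counting flags; for v = 0 the
-- blocks are three distinct singletons of a 3-set, hence all of them.
replication : ∀ v (ℬ : List (Subset (4 * v + 3))) → Unique ℬ → (∀ {B} → B ∈ ℬ → ∣ B ∣ ≡ 2 * v + 1) →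
  length ℬ ≡ 4 * v + 3 → (∀ z → ∣ z ∣ ≡ 2 → degree ℬ z ≡ v) →
  ∀ z → ∣ z ∣ ≡ 1 → degree ℬ z ≡ 2 * v + 1
replication zero ℬ unique size length≡ deg₂ z ∣z∣≡1 = begin
  degree ℬ z            ≡⟨ ∑-↭ (λ y → [ z ⊑ y ]) (↭-sym all-singletons) ⟩
  degree (shell 3 1) z  ≡⟨ degree-shell 3 1 z ⟩
  shellDegree 3 1 ∣ z ∣ ≡⟨ cong (shellDegree 3 1) ∣z∣≡1 ⟩
  1                     ∎
  where
  all-singletons : shell 3 1 ↭ ℬ
  all-singletons = unique-⊆-length⇒↭ unique
    (λ {B} B∈ → ∈-filter⁺ (λ x → ∣ x ∣ ≟ 1) (∈-allPoints B) (size B∈)) length≡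
replication v@(suc _) ℬ unique size length≡ deg₂ z ∣z∣≡1 =
  *-cancelʳ-≡ (degree ℬ z) (2 * v + 1) (2 * v) (begin
    degree ℬ z * (2 * v)
      ≡⟨ sym (∑-*ʳ ℬ (2 * v) (λ y → [ z ⊑ y ])) ⟩
    ∑ ℬ (λ y → [ z ⊑ y ] * (2 * v))
      ≡⟨ ∑-cong-∈ ℬ (λ {y} y∈ → cong ([ z ⊑ y ] *_)
           (sym (trans (cong₂ _∸_ (size y∈) ∣z∣≡1) (m+n∸n≡m (2 * v) 1)))) ⟩
    ∑ ℬ (λ y → [ z ⊑ y ] * (∣ y ∣ ∸ ∣ z ∣))
      ≡⟨ ∑-neighbours ℬ z (λ z′ e → deg₂ z′ (trans e (cong (_+ 1) ∣z∣≡1))) ⟩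
    (4 * v + 3 ∸ ∣ z ∣) * v
      ≡⟨ cong (_* v) (trans (cong (4 * v + 3 ∸_) ∣z∣≡1) (+-∸-assoc (4 * v) {3} {1} (s≤s z≤n))) ⟩
    (4 * v + 2) * v
      ≡⟨ rearrange v ⟩
    (2 * v + 1) * (2 * v) ∎)
  where
  rearrange : ∀ v → (4 * v + 2) * v ≡ (2 * v + 1) * (2 * v)
  rearrange = solve-∀

-- The shells of sizes 2u - 1 and 2u, with v = u - 1

module TwoShells (v : ℕ) (𝒴 : WeightedSubset (4 * v + 3) (2 * v + 1) (2 * v + 2))
  (w≡1 : ∀ {y} → y ∈ WeightedSubset.Y 𝒴 → WeightedSubset.w 𝒴 y ≡ 1ℚ) where
  open WeightedSubset 𝒴
  open UnitWeights 𝒴 w≡1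

  N r₁ r₂ : ℕ
  N  = 4 * v + 3
  r₁ = 2 * v + 1
  r₂ = 2 * v + 2

  Y₁ Y₂ : List (Subset N)
  Y₁ = Y[_] 𝒴 r₁
  Y₂ = Y[_] 𝒴 r₂

  r₁<r₂ : r₁ < r₂
  r₁<r₂ = +-monoʳ-< (2 * v) (s≤s (s≤s z≤n))

  n≡r₁+r₂ : N ≡ r₁ + r₂
  n≡r₁+r₂ = solved v
    where
    solved : ∀ v → 4 * v + 3 ≡ (2 * v + 1) + (2 * v + 2)
    solved = solve-∀

  r₁≤n : r₁ ≤ N
  r₁≤n = subst (r₁ ≤_) (sym n≡r₁+r₂) (m≤m+n r₁ r₂)

  r₂≤n : r₂ ≤ N
  r₂≤n = subst (r₂ ≤_) (sym n≡r₁+r₂) (m≤n+m r₂ r₁)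

  0<n : 0 < N
  0<n = ≤-trans (s≤s z≤n) (m≤n+m 3 (4 * v))

  ∣∁∣-r₁ : ∀ (y : Subset N) → ∣ y ∣ ≡ r₁ → ∣ ∁ y ∣ ≡ r₂
  ∣∁∣-r₁ y e = trans (∣∁p∣≡n∸∣p∣ y) (trans (cong₂ _∸_ n≡r₁+r₂ e) (m+n∸m≡n r₁ r₂))

  ∣∁∣-r₂ : ∀ (y : Subset N) → ∣ y ∣ ≡ r₂ → ∣ ∁ y ∣ ≡ r₁
  ∣∁∣-r₂ y e = trans (∣∁p∣≡n∸∣p∣ y) (trans (cong₂ _∸_ n≡r₁+r₂ e) (m+n∸n≡m r₁ r₂))

  length-Y : length Y ≡ length Y₁ + length Y₂
  length-Y = trans (sym (∑-one Y))
    (trans (∑-shells (<⇒≢ r₁<r₂) (λ _ → 1)) (cong₂ _+_ (∑-one Y₁) (∑-one Y₂)))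

  -- The average of f z over X_r for ∣ z ∣ = j is ρ₁ j / d j if r = r₁ and
  -- ρ₂ j / d j if r = r₂; τ j is the value N (ρ₁ j + ρ₂ j) / d j.
  -- Only j = 1, 2, 3 matter.
  d ρ₁ ρ₂ τ : ℕ → ℕ
  d  1 = N
  d  2 = N
  d  _ = (4 * v + 1) * N
  ρ₁ 1 = r₁
  ρ₁ 2 = v
  ρ₁ _ = (r₁ ∸ 2) * v
  ρ₂ 1 = r₂
  ρ₂ 2 = v + 1
  ρ₂ _ = (2 * v) * (v + 1)
  τ  1 = N
  τ  2 = r₁
  τ  _ = v

  0<d : ∀ j → 0 < d j
  0<d 0 = *-mono-≤ (m≤n+m 1 (4 * v)) 0<n
  0<d 1 = 0<n
  0<d 2 = 0<n
  0<d (suc (suc (suc _))) = *-mono-≤ (m≤n+m 1 (4 * v)) 0<n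

  ratio₁ : ∀ j → 1 ≤ j → j ≤ 3 → d j * shellDegree N r₁ j ≡ ρ₁ j * shellDegree N r₁ 0
  ratio₁ 1 _ _ = shellRatio₁ v r₁
  ratio₁ 2 _ _ = shellRatio₂ v r₁ (2 * v) v (m+n∸n≡m (2 * v) 1) (product v)
    where
    product : ∀ v → 2 * v * (2 * v + 1) ≡ (4 * v + 2) * v
    product = solve-∀
  ratio₁ 3 _ _ = shellRatio₃ v r₁ (r₁ ∸ 2) v refl (ratio₁ 2 (s≤s z≤n) (s≤s (s≤s z≤n)))
  ratio₁ (suc (suc (suc (suc _)))) _ (s≤s (s≤s (s≤s ())))

  ratio₂ : ∀ j → 1 ≤ j → j ≤ 3 → d j * shellDegree N r₂ j ≡ ρ₂ j * shellDegree N r₂ 0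
  ratio₂ 1 _ _ = shellRatio₁ v r₂
  ratio₂ 2 _ _ = shellRatio₂ v r₂ r₁ (v + 1) (+-∸-assoc (2 * v) {2} {1} (s≤s z≤n)) (product v)
    where
    product : ∀ v → (2 * v + 1) * (2 * v + 2) ≡ (4 * v + 2) * (v + 1)
    product = solve-∀
  ratio₂ 3 _ _ = shellRatio₃ v r₂ (2 * v) (v + 1) (m+n∸n≡m (2 * v) 2)
                   (ratio₂ 2 (s≤s z≤n) (s≤s (s≤s z≤n)))
  ratio₂ (suc (suc (suc (suc _)))) _ (s≤s (s≤s (s≤s ())))

  dτ : ∀ j → 1 ≤ j → j ≤ 3 → d j * τ j ≡ N * ρ₁ j + N * ρ₂ j
  dτ 1 _ _ = trans (cong (N *_) n≡r₁+r₂) (*-distribˡ-+ N r₁ r₂)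
  dτ 2 _ _ = trans (cong (N *_) (halves v)) (*-distribˡ-+ N v (v + 1))
    where
    halves : ∀ v → 2 * v + 1 ≡ v + (v + 1)
    halves = solve-∀
  dτ 3 _ _ = begin
    (4 * v + 1) * N * v               ≡⟨ expand N v ⟩
    N * (2 * v * v + 2 * v * v + v)   ≡⟨ cong (λ t → N * (t + 2 * v * v + v)) (sym (truncated v)) ⟩
    N * ((r₁ ∸ 2) * v + v + 2 * v * v + v) ≡⟨ collect N v ((r₁ ∸ 2) * v) ⟩
    N * ((r₁ ∸ 2) * v) + N * ((2 * v) * (v + 1)) ∎
    where
    expand : ∀ N v → (4 * v + 1) * N * v ≡ N * (2 * v * v + 2 * v * v + v)
    expand = solve-∀
    collect : ∀ N v t → N * (t + v + 2 * v * v + v) ≡ N * t + N * ((2 * v) * (v + 1))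
    collect = solve-∀
    -- For v = 0 the difference is cut off at 0 instead of -1, which is harmless because of the
    -- factor v.
    truncated : ∀ v → (2 * v + 1 ∸ 2) * v + v ≡ 2 * v * v
    truncated zero    = refl
    truncated (suc v) = begin
      (2 * suc v + 1 ∸ 2) * suc v + suc v ≡⟨ cong (λ t → (t ∸ 2) * suc v + suc v) (odd v) ⟩
      (2 * v + 1 + 2 ∸ 2) * suc v + suc v ≡⟨ cong (λ t → t * suc v + suc v) (m+n∸n≡m (2 * v + 1) 2) ⟩
      (2 * v + 1) * suc v + suc v         ≡⟨ even v ⟩
      2 * suc v * suc v                   ∎
      where
      odd : ∀ v → 2 * suc v + 1 ≡ 2 * v + 1 + 2
      odd = solve-∀
      even : ∀ v → (2 * v + 1) * suc v + suc v ≡ 2 * suc v * suc v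
      even = solve-∀
  dτ (suc (suc (suc (suc _)))) _ (s≤s (s≤s (s≤s ())))

  module _ {j} (1≤j : 1 ≤ j) (j≤3 : j ≤ 3) (z : Subset N) (∣z∣≡j : ∣ z ∣ ≡ j) where
    private
      ratio₁′ : d j * shellDegree N r₁ ∣ z ∣ ≡ ρ₁ j * shellDegree N r₁ 0
      ratio₁′ = trans (cong (λ t → d j * shellDegree N r₁ t) ∣z∣≡j) (ratio₁ j 1≤j j≤3)
      ratio₂′ : d j * shellDegree N r₂ ∣ z ∣ ≡ ρ₂ j * shellDegree N r₂ 0
      ratio₂′ = trans (cong (λ t → d j * shellDegree N r₂ t) ∣z∣≡j) (ratio₂ j 1≤j j≤3)

    design⇒degree : IsRelativeDesign 𝒴 3 → d j * degree Y z ≡ length Y₁ * ρ₁ j + length Y₂ * ρ₂ j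
    design⇒degree D = balanced⇒degree z {ρ₁ = ρ₁ j} {ρ₂ j} (0<d j) r₁≤n r₂≤n ratio₁′ ratio₂′
      (IsRelativeDesign.balanced D j 1≤j j≤3 z ∣z∣≡j)

    design⇒τ : IsRelativeDesign 𝒴 3 → length Y₁ ≡ N → length Y₂ ≡ N → degree Y z ≡ τ j
    design⇒τ D e₁ e₂ = *-cancelˡ-≡ (degree Y z) (τ j) (d j) {{>-nonZero (0<d j)}} (begin
      d j * degree Y z                       ≡⟨ design⇒degree D ⟩
      length Y₁ * ρ₁ j + length Y₂ * ρ₂ j    ≡⟨ cong₂ (λ a b → a * ρ₁ j + b * ρ₂ j) e₁ e₂ ⟩
      N * ρ₁ j + N * ρ₂ j                    ≡⟨ sym (dτ j 1≤j j≤3) ⟩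
      d j * τ j                              ∎)

    τ⇒balanced : degree Y z ≡ τ j → length Y₁ ≡ N → length Y₂ ≡ N →
                 shellTerm 𝒴 r₁ z ℚ.+ shellTerm 𝒴 r₂ z ≡ ∑[ Y ] (λ y → w y ℚ.* f z y)
    τ⇒balanced deg e₁ e₂ = degree⇒balanced z {ρ₁ = ρ₁ j} {ρ₂ j} (0<d j) r₁≤n r₂≤n ratio₁′ ratio₂′ (begin
      d j * degree Y z                       ≡⟨ cong (d j *_) deg ⟩
      d j * τ j                              ≡⟨ dτ j 1≤j j≤3 ⟩
      N * ρ₁ j + N * ρ₂ j                    ≡⟨ sym (cong₂ (λ a b → a * ρ₁ j + b * ρ₂ j) e₁ e₂) ⟩
      length Y₁ * ρ₁ j + length Y₂ * ρ₂ j    ∎)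

  module Complementary (complement : IsComplementOf Y₂ Y₁) where

    -- Both lists are duplicate-free, as `∁` is injective, so equality as sets is equality with
    -- multiplicities. Sums over `Y₂` can then be rewritten as sums over `Y₁`.
    Y₂↭∁Y₁ : Y₂ ↭ map ∁ Y₁
    Y₂↭∁Y₁ = ∼bag⇒↭ (unique∧set⇒bag (unique[] r₂) (Unique.map⁺ ∁-injective (unique[] r₁)) complement)

    length-Y₂ : length Y₂ ≡ length Y₁
    length-Y₂ = trans (↭.↭-length Y₂↭∁Y₁) (length-map ∁ Y₁)

    degree-Y : ∀ z → degree Y z ≡ ∑ Y₁ (λ y → [ z ⊑ y ] + [ z ⊑ ∁ y ])
    degree-Y z = begin
      degree Y z                                     ≡⟨ ∑-shells (<⇒≢ r₁<r₂) [ z ⊑_] ⟩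
      degree Y₁ z + degree Y₂ z                      ≡⟨ cong (degree Y₁ z +_) (∑-↭ [ z ⊑_] Y₂↭∁Y₁) ⟩
      degree Y₁ z + degree (map ∁ Y₁) z              ≡⟨ cong (degree Y₁ z +_) (∑-map ∁ Y₁ [ z ⊑_]) ⟩
      degree Y₁ z + ∑ Y₁ (λ y → [ z ⊑ ∁ y ])         ≡⟨ sym (∑-+ Y₁ [ z ⊑_] (λ y → [ z ⊑ ∁ y ])) ⟩
      ∑ Y₁ (λ y → [ z ⊑ y ] + [ z ⊑ ∁ y ])           ∎

    degree-single : ∀ z → ∣ z ∣ ≡ 1 → degree Y z ≡ length Y₁
    degree-single z e = trans (degree-Y z)
      (trans (∑-cong Y₁ (λ y → ⊑-single z y e)) (∑-one Y₁))

    degree-+-∑-∣∩∣ : ∀ z (g : Subset N → ℕ) →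
      (∀ y → [ z ⊑ y ] + [ z ⊑ ∁ y ] + ∣ z ∩ y ∣ ≡ 1 + g y) →
      degree Y z + ∑ Y₁ (λ y → ∣ z ∩ y ∣) ≡ length Y₁ + ∑ Y₁ g
    degree-+-∑-∣∩∣ z g e = begin
      degree Y z + ∑ Y₁ (λ y → ∣ z ∩ y ∣)
        ≡⟨ cong (_+ ∑ Y₁ (λ y → ∣ z ∩ y ∣)) (degree-Y z) ⟩
      ∑ Y₁ (λ y → [ z ⊑ y ] + [ z ⊑ ∁ y ]) + ∑ Y₁ (λ y → ∣ z ∩ y ∣)
        ≡⟨ sym (∑-+ Y₁ (λ y → [ z ⊑ y ] + [ z ⊑ ∁ y ]) (λ y → ∣ z ∩ y ∣)) ⟩
      ∑ Y₁ (λ y → [ z ⊑ y ] + [ z ⊑ ∁ y ] + ∣ z ∩ y ∣)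
        ≡⟨ ∑-cong Y₁ e ⟩
      ∑ Y₁ (λ y → 1 + g y)
        ≡⟨ trans (∑-+ Y₁ (λ _ → 1) g) (cong (_+ ∑ Y₁ g) (∑-one Y₁)) ⟩
      length Y₁ + ∑ Y₁ g ∎

    module _ (length-Y₁ : length Y₁ ≡ N) (deg₁ : ∀ z → ∣ z ∣ ≡ 1 → degree Y₁ z ≡ r₁) where

      degree-pair : ∀ z → ∣ z ∣ ≡ 2 → degree Y z + 2 * r₁ ≡ N + 2 * degree Y₁ z
      degree-pair z e = begin
        degree Y z + 2 * r₁
          ≡⟨ cong (degree Y z +_) (trans (cong (_* r₁) (sym e)) (sym (∑-∣∩∣ Y₁ z deg₁))) ⟩
        degree Y z + ∑ Y₁ (λ y → ∣ z ∩ y ∣)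
          ≡⟨ degree-+-∑-∣∩∣ z (λ y → 2 * [ z ⊑ y ]) (λ y → ⊑-pair z y e) ⟩
        length Y₁ + ∑ Y₁ (λ y → 2 * [ z ⊑ y ])
          ≡⟨ cong₂ _+_ length-Y₁ (∑-*ˡ Y₁ 2 [ z ⊑_]) ⟩
        N + 2 * degree Y₁ z ∎

      -- With m = ∣ z ∩ y ∣, the indicator of z ⊆ `∁ y` is 1 - m + (m choose 2) - (m choose 3), and
      -- that of z ⊆ y is (m choose 3). The cubic terms cancel over each pair y, `∁ y`, so the
      -- points and pairs of z fix its degree in `Y`.
      degree-triple : (∀ z → ∣ z ∣ ≡ 2 → degree Y₁ z ≡ v) →
                      ∀ z → ∣ z ∣ ≡ 3 → degree Y z + 3 * r₁ ≡ N + 3 * v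
      degree-triple deg₂ z e = begin
        degree Y z + 3 * r₁
          ≡⟨ cong (degree Y z +_) (trans (cong (_* r₁) (sym e)) (sym (∑-∣∩∣ Y₁ z deg₁))) ⟩
        degree Y z + ∑ Y₁ (λ y → ∣ z ∩ y ∣)
          ≡⟨ degree-+-∑-∣∩∣ z (λ y → ∣ z ∩ y ∣ C 2) (λ y → ⊑-triple z y e) ⟩
        length Y₁ + ∑ Y₁ (λ y → ∣ z ∩ y ∣ C 2)
          ≡⟨ cong₂ _+_ length-Y₁ (trans (∑-moment Y₁ z 2 deg₂) (cong (λ t → (t C 2) * v) e)) ⟩
        N + 3 * v ∎

  -- From a tight relative design to complementary designs

  tight⇒design : IsTightRelativeDesign 𝒴 1 → IsSymmetric2Design N r₁ v Y₁ × IsComplementOf Y₂ Y₁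
  tight⇒design T = record
    { is2Design = record
      { unique    = unique[] r₁
      ; blockSize = λ B∈ → proj₂ (∈-Y[] B∈)
      ; balanced  = λ i j i≢j → trans (length-blocksThrough i j Y₁) (deg-Y₁₂ (⁅ i ⁆ ∪ ⁅ j ⁆) (pair-∣∣ i≢j))
      }
    ; symmetric = length-Y₁
    } , complement
    where
    open IsTightRelativeDesign T

    ∃z : ∃[ z ] ∣ z ∣ ≡ 1
    ∃z = ⁅ fromℕ< 0<n ⁆ , ∣⁅x⁆∣≡1 (fromℕ< 0<n)

    sum≡2n : length Y₁ + length Y₂ ≡ 2 * N
    sum≡2n = trans (sym length-Y) (trans tight (cong (2 *_) (nC1≡n N)))

    -- As r₂ = r₁ + 1 and both shells together have 2N members, the condition for one point reads N
    -- * degree = 2 r₁ N + ∣Y₂∣.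
    n∣Y₂ : N ∣ length Y₂
    n∣Y₂ = ∣m+n∣m⇒∣n (divides (degree Y (proj₁ ∃z)) (begin
        2 * r₁ * N + length Y₂
          ≡⟨ cong (_+ length Y₂) (trans (*-assoc 2 r₁ N) (trans (cong (2 *_) (*-comm r₁ N)) (sym (*-assoc 2 N r₁)))) ⟩
        2 * N * r₁ + length Y₂
          ≡⟨ cong (λ t → t * r₁ + length Y₂) (sym sum≡2n) ⟩
        (length Y₁ + length Y₂) * r₁ + length Y₂
          ≡⟨ collect (length Y₁) (length Y₂) v ⟩
        length Y₁ * r₁ + length Y₂ * r₂
          ≡⟨ sym (design⇒degree (s≤s z≤n) (s≤s z≤n) (proj₁ ∃z) (proj₂ ∃z) isRelativeDesign) ⟩
        N * degree Y (proj₁ ∃z)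
          ≡⟨ *-comm N _ ⟩
        degree Y (proj₁ ∃z) * N ∎))
      (divides (2 * r₁) refl)
      where
      collect : ∀ a b v → (a + b) * (2 * v + 1) + b ≡ a * (2 * v + 1) + b * (2 * v + 2)
      collect = solve-∀

    length-Y₂ : length Y₂ ≡ N
    length-Y₂ = half-of-double n∣Y₂ (∈-length (proj₂ nonempty₁)) (∈-length (proj₂ nonempty₂)) sum≡2n

    length-Y₁ : length Y₁ ≡ N
    length-Y₁ = +-cancelʳ-≡ N (length Y₁) N
      (trans (cong (length Y₁ +_) (sym length-Y₂)) (trans sum≡2n (cong (N +_) (+-identityʳ N))))

    deg₁ : ∀ z → ∣ z ∣ ≡ 1 → degree Y z ≡ N
    deg₁ z e = design⇒τ (s≤s z≤n) (s≤s z≤n) z e isRelativeDesign length-Y₁ length-Y₂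

    deg₂ : ∀ z → ∣ z ∣ ≡ 2 → degree Y z ≡ r₁
    deg₂ z e = design⇒τ (s≤s z≤n) (s≤s (s≤s z≤n)) z e isRelativeDesign length-Y₁ length-Y₂

    deg₃ : ∀ z → ∣ z ∣ ≡ 3 → degree Y z ≡ v
    deg₃ z e = design⇒τ (s≤s z≤n) (s≤s (s≤s (s≤s z≤n))) z e isRelativeDesign length-Y₁ length-Y₂

    module Moments (x : Subset N) (∣x∣≡ : ∣ x ∣ ≡ r₂) = CentralMoments {v = v} Y x
      (trans tight (cong (2 *_) (nC1≡n N))) ∣x∣≡ deg₁ deg₂ deg₃

    ∁-Y₂ : ∀ {x} → x ∈ Y₂ → ∁ x ∈ Y₁
    ∁-Y₂ {x} x∈ = opposite (Moments.∃-disjoint x ∣x∣≡ (proj₁ (∈-Y[] x∈)))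
      where
      ∣x∣≡ : ∣ x ∣ ≡ r₂
      ∣x∣≡ = proj₂ (∈-Y[] x∈)
      opposite : ∃[ y ] y ∈ Y × ∣ x ∩ y ∣ ≡ 0 → ∁ x ∈ Y₁
      opposite (y , y∈ , disjoint) = by-shell (two-shells y∈)
        where
        x⊆∁y : x ⊆ ∁ y
        x⊆∁y = ⊑-sound x (∁ y) (trans (⊑-∁-∣∩∣ x y) (cong [_≐ 0 ] disjoint))
        by-shell : ∣ y ∣ ≡ r₁ ⊎ ∣ y ∣ ≡ r₂ → ∁ x ∈ Y₁
        by-shell (inj₁ e) = subst (_∈ Y₁)
          (trans (sym (∁-involutive y)) (cong ∁ (sym (⊆-∣∣≡⇒≡ x⊆∁y (trans ∣x∣≡ (sym (∣∁∣-r₁ y e)))))))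
          (Y[]-∈ y∈ e)
        -- `∁ y` would have only `r₁` points, too few to contain `x`: two members of `Y₂` always
        -- meet.
        by-shell (inj₂ e) = contradiction (subst₂ _≤_ ∣x∣≡ (∣∁∣-r₂ y e) (p⊆q⇒∣p∣≤∣q∣ x⊆∁y)) (<⇒≱ r₁<r₂)

    ∁-Y₁ : ∀ {y} → y ∈ Y₁ → ∁ y ∈ Y₂
    -- `∁ y` is the test set; `y` itself, being disjoint from it, is the member whose term exhausts
    -- the sum.
    ∁-Y₁ {y} y∈ = match (Moments.∃-containing (∁ y) ∣∁y∣≡ (proj₁ (∈-Y[] y∈)) disjoint)
      where
      ∣∁y∣≡ : ∣ ∁ y ∣ ≡ r₂
      ∣∁y∣≡ = ∣∁∣-r₁ y (proj₂ (∈-Y[] y∈))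
      disjoint : ∣ ∁ y ∩ y ∣ ≡ 0
      disjoint = trans (cong ∣_∣ (∩-inverseˡ y)) (∣⊥∣≡0 N)
      match : ∃[ x ] x ∈ Y × ∣ ∁ y ∩ x ∣ ≡ ∣ ∁ y ∣ → ∁ y ∈ Y₂
      match (x , x∈ , e) = by-shell (two-shells x∈)
        where
        ∁y⊆x : ∁ y ⊆ x
        ∁y⊆x = ⊑-sound (∁ y) x (trans (⊑-∣∩∣ (∁ y) x) (trans (cong [_≐ ∣ ∁ y ∣ ] e) (≐-refl ∣ ∁ y ∣)))
        by-shell : ∣ x ∣ ≡ r₁ ⊎ ∣ x ∣ ≡ r₂ → ∁ y ∈ Y₂
        by-shell (inj₁ e′) = contradiction (subst₂ _≤_ ∣∁y∣≡ e′ (p⊆q⇒∣p∣≤∣q∣ ∁y⊆x)) (<⇒≱ r₁<r₂)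
        by-shell (inj₂ e′) = subst (_∈ Y₂) (sym (⊆-∣∣≡⇒≡ ∁y⊆x (trans ∣∁y∣≡ (sym e′)))) (Y[]-∈ x∈ e′)

    complement : IsComplementOf Y₂ Y₁
    complement = mk⇔
      (λ {x∈ → subst (_∈ map ∁ Y₁) (∁-involutive _) (∈-map⁺ ∁ (∁-Y₂ x∈))})
      (λ x∈ → from-map (∈-map⁻ ∁ x∈))
      where
      from-map : ∀ {x} → ∃[ y ] y ∈ Y₁ × x ≡ ∁ y → x ∈ Y₂
      from-map (y , y∈ , x≡) = subst (_∈ Y₂) (sym x≡) (∁-Y₁ y∈)

    open Complementary complement using (degree-pair)

    -- Complementation gives no information, since a point lies in exactly one of y and `∁ y`. Flags
    -- give a second relation besides a + b = N: a member through `z` has 2v further points in `Y₁`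
    -- but 2v + 1 in `Y₂`, and this difference of one isolates `a`.
    deg-Y₁₁ : ∀ z → ∣ z ∣ ≡ 1 → degree Y₁ z ≡ r₁
    deg-Y₁₁ z e = +-cancelˡ-≡ ((4 * v + 2) * r₁) (degree Y₁ z) r₁ (begin
      (4 * v + 2) * r₁ + a               ≡⟨ cong (_+ a) (sym flags) ⟩
      a * (2 * v) + b * r₁ + a           ≡⟨ collect a b v ⟩
      (a + b) * r₁                       ≡⟨ cong (_* r₁) (trans (sym (∑-shells (<⇒≢ r₁<r₂) [ z ⊑_])) (deg₁ z e)) ⟩
      N * r₁                             ≡⟨ split v ⟩
      (4 * v + 2) * r₁ + r₁              ∎)
      where
      a b : ℕ
      a = degree Y₁ z
      b = degree Y₂ z
      collect : ∀ a b v → a * (2 * v) + b * (2 * v + 1) + a ≡ (a + b) * (2 * v + 1)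
      collect = solve-∀
      split : ∀ v → (4 * v + 3) * (2 * v + 1) ≡ (4 * v + 2) * (2 * v + 1) + (2 * v + 1)
      split = solve-∀
      onShell-flags : ∀ r k → r ∸ 1 ≡ k →
        ∑ (Y[_] 𝒴 r) (λ y → [ z ⊑ y ] * (∣ y ∣ ∸ ∣ z ∣)) ≡ degree (Y[_] 𝒴 r) z * k
      onShell-flags r k r∸1 = trans
        (∑-cong-∈ (Y[_] 𝒴 r) (λ {y} y∈ → cong ([ z ⊑ y ] *_)
          (trans (cong₂ _∸_ (proj₂ (∈-Y[] y∈)) e) r∸1)))
        (∑-*ʳ (Y[_] 𝒴 r) k [ z ⊑_])
      flags : a * (2 * v) + b * r₁ ≡ (4 * v + 2) * r₁
      flags = begin
        a * (2 * v) + b * r₁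
          ≡⟨ sym (cong₂ _+_ (onShell-flags r₁ (2 * v) (m+n∸n≡m (2 * v) 1))
                            (onShell-flags r₂ r₁ (+-∸-assoc (2 * v) {2} {1} (s≤s z≤n)))) ⟩
        _ ≡⟨ sym (∑-shells (<⇒≢ r₁<r₂) (λ y → [ z ⊑ y ] * (∣ y ∣ ∸ ∣ z ∣))) ⟩
        ∑ Y (λ y → [ z ⊑ y ] * (∣ y ∣ ∸ ∣ z ∣))
          -- Each of the other N - 1 = 4v + 2 points lies together with `z` in `r₁` members.
          ≡⟨ ∑-neighbours Y z (λ z′ e′ → deg₂ z′ (trans e′ (cong (_+ 1) e))) ⟩
        (N ∸ ∣ z ∣) * r₁
          ≡⟨ cong (_* r₁) (trans (cong (N ∸_) e) (+-∸-assoc (4 * v) {3} {1} (s≤s z≤n))) ⟩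
        (4 * v + 2) * r₁ ∎

    deg-Y₁₂ : ∀ z → ∣ z ∣ ≡ 2 → degree Y₁ z ≡ v
    deg-Y₁₂ z e = *-cancelˡ-≡ (degree Y₁ z) v 2 (+-cancelˡ-≡ N (2 * degree Y₁ z) (2 * v) (begin
      N + 2 * degree Y₁ z ≡⟨ sym (degree-pair length-Y₁ deg-Y₁₁ z e) ⟩
      degree Y z + 2 * r₁ ≡⟨ cong (_+ 2 * r₁) (deg₂ z e) ⟩
      r₁ + 2 * r₁         ≡⟨ total v ⟩
      N + 2 * v           ∎))
      where
      total : ∀ v → (2 * v + 1) + 2 * (2 * v + 1) ≡ (4 * v + 3) + 2 * v
      total = solve-∀

  -- From complementary designs to a tight relative design

  design⇒tight : IsSymmetric2Design N r₁ v Y₁ → IsComplementOf Y₂ Y₁ → IsTightRelativeDesign 𝒴 1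
  design⇒tight D complement = record
    { isRelativeDesign = record
      { distinct = <⇒≢ r₁<r₂
      ; balanced = λ j 1≤j j≤3 z e → τ⇒balanced 1≤j j≤3 z e (degree≡τ j 1≤j j≤3 z e) symmetric length-Y₂′
      }
    ; nonempty₁ = nonempty (subst (0 <_) (sym symmetric) 0<n)
    ; nonempty₂ = nonempty (subst (0 <_) (sym length-Y₂′) 0<n)
    ; constant₁ = constant
    ; constant₂ = constant
    ; tight     = trans length-Y (trans (cong₂ _+_ symmetric length-Y₂′)
                    (trans (cong (N +_) (sym (+-identityʳ N))) (cong (2 *_) (sym (nC1≡n N)))))
    }
    where
    open IsSymmetric2Design D
    open Complementary complement

    constant : ∀ {r x y} → x ∈ Y[_] 𝒴 r → y ∈ Y[_] 𝒴 r → w x ≡ w y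
    constant x∈ y∈ = trans (w≡1 (proj₁ (∈-Y[] x∈))) (sym (w≡1 (proj₁ (∈-Y[] y∈))))

    length-Y₂′ : length Y₂ ≡ N
    length-Y₂′ = trans length-Y₂ symmetric

    deg₂ : ∀ z → ∣ z ∣ ≡ 2 → degree Y₁ z ≡ v
    deg₂ z e = through (∣∣≡2⇒pair z e)
      where
      through : (∃[ i ] ∃[ j ] i ≢ j × z ≡ ⁅ i ⁆ ∪ ⁅ j ⁆) → degree Y₁ z ≡ v
      through (i , j , i≢j , refl) =
        trans (sym (length-blocksThrough i j Y₁)) (Is2Design.balanced is2Design i j i≢j)

    deg₁ : ∀ z → ∣ z ∣ ≡ 1 → degree Y₁ z ≡ r₁
    deg₁ = replication v Y₁ (unique[] r₁) (λ B∈ → proj₂ (∈-Y[] B∈)) symmetric deg₂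

    degree≡τ : ∀ j → 1 ≤ j → j ≤ 3 → ∀ z → ∣ z ∣ ≡ j → degree Y z ≡ τ j
    degree≡τ 1 _ _ z e = trans (degree-single z e) symmetric
    degree≡τ 2 _ _ z e = +-cancelʳ-≡ (2 * r₁) (degree Y z) r₁ (begin
      degree Y z + 2 * r₁ ≡⟨ degree-pair symmetric deg₁ z e ⟩
      N + 2 * degree Y₁ z ≡⟨ cong (λ t → N + 2 * t) (deg₂ z e) ⟩
      N + 2 * v           ≡⟨ total v ⟩
      r₁ + 2 * r₁         ∎)
      where
      total : ∀ v → (4 * v + 3) + 2 * v ≡ (2 * v + 1) + 2 * (2 * v + 1)
      total = solve-∀
    degree≡τ 3 _ _ z e = +-cancelʳ-≡ (3 * r₁) (degree Y z) v (begin
      degree Y z + 3 * r₁ ≡⟨ degree-triple symmetric deg₁ deg₂ z e ⟩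
      N + 3 * v           ≡⟨ total v ⟩
      v + 3 * r₁          ∎)
      where
      total : ∀ v → (4 * v + 3) + 3 * v ≡ v + 3 * (2 * v + 1)
      total = solve-∀
    degree≡τ (suc (suc (suc (suc _)))) _ (s≤s (s≤s (s≤s ())))

-- The parameters are variables with equations, so that matching on `refl` carries the dependent
-- type `WeightedSubset` from 4u - 1, 2u - 1, 2u over to forms without subtraction.
tight⇔design : ∀ v {n r₁ r₂} → n ≡ 4 * v + 3 → r₁ ≡ 2 * v + 1 → r₂ ≡ 2 * v + 2 →
  (𝒴 : WeightedSubset n r₁ r₂) →
  (∀ {y} → y ∈ WeightedSubset.Y 𝒴 → WeightedSubset.w 𝒴 y ≡ 1ℚ) →
  IsTightRelativeDesign 𝒴 1 ⇔
  (IsSymmetric2Design n r₁ v (Y[_] 𝒴 r₁) × IsComplementOf (Y[_] 𝒴 r₂) (Y[_] 𝒴 r₁))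
tight⇔design v refl refl refl 𝒴 w≡1 =
  mk⇔ tight⇒design (λ (D , complement) → design⇒tight D complement)
  where open TwoShells v 𝒴 w≡1

theorem3p6 : (u : ℕ) → 1 ≤ u →
    (𝒴 : WeightedSubset (4 * u ∸ 1) (2 * u ∸ 1) (2 * u)) →
    (∀ {y} → y ∈ WeightedSubset.Y 𝒴 → WeightedSubset.w 𝒴 y ≡ 1ℚ) →
    IsTightRelativeDesign 𝒴 1 ⇔
    (IsSymmetric2Design (4 * u ∸ 1) (2 * u ∸ 1) (u ∸ 1) (Y[_] 𝒴 (2 * u ∸ 1))
    × IsComplementOf (Y[_] 𝒴 (2 * u)) (Y[_] 𝒴 (2 * u ∸ 1)))
theorem3p6 (suc v) _ = tight⇔design v (cong (_∸ 1) (n≡ v)) (cong (_∸ 1) (r₁≡ v)) (r₂≡ v)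
  where
  n≡ : ∀ v → 4 * suc v ≡ suc (4 * v + 3)
  n≡ = solve-∀
  r₁≡ : ∀ v → 2 * suc v ≡ suc (2 * v + 1)
  r₁≡ = solve-∀
  r₂≡ : ∀ v → 2 * suc v ≡ 2 * v + 2
  r₂≡ = solve-∀
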